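{- Let $P \subset \mathbb{R}^d$ be an $r$-dimensional lattice polytope and let $n \ge 1$ be an integer. Then \[ \mathrm{CE}(\operatorname{relint}(P);n) \;=\; (-1)^r\, \mathrm{CE}(P;-n), \] where $\mathrm{CE}(P;-n) := \sum_{i=0}^r e_i(P)\, J_i(-n)$ and $J_k(-n) := (-1)^k J_k(n)$.
   Context: A lattice polytope is a convex polytope with all vertices in $\mathbb{Z}^d$; $\operatorname{relint}(P)$ is its relative interior. For a set $S\subseteq\mathbb{R}^d$ and $n\ge 1$, $nS=\{ns : s\in S\}$ and \[ \mathrm{CE}(S;n) = |\{(a_1,\dots,a_d) \in nS \cap \mathbb{Z}^d : \gcd(a_1,\dots,a_d,n) = 1\}|. \] The Ehrhart polynomial of $P$ is the polynomial $e_r(P)n^r+\cdots+e_0(P)$ ($r=\dim P$) agreeing with $|nP\cap\mathbb{Z}^d|$ for all $n\ge0$. For $k\ge 0$ and $n \ge 1$, the Jordan totient function is $J_k(n) = |\{(a_1,\dots,a_k)\in\mathbb{Z}^k : 1 \le a_i \le n,\ \gcd(a_1,\dots,a_k,n)=1\}|$ (so $J_0(n)=1$ if $n=1$ and $0$ otherwise), and equivalently $J_k(n) = n^k\prod_{p\mid n}(1-p^{ -k})$ over primes $p$. -}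

module Defs where

open import Data.Nat as ℕ using (ℕ; zero; suc)
open import Data.Nat.GCD using (gcd)
open import Data.Integer as ℤ using (ℤ; +_; ∣_∣)
open import Data.Rational as ℚ using (ℚ; 0ℚ; 1ℚ; _+_; _*_; -_; _≤_; _<_)
open import Data.Fin using (Fin; zero; suc)
open import Data.Vec as Vec using (Vec; []; _∷_)
open import Data.List as List using (List; []; _∷_; filter; length; concatMap; map)
open import Data.List.Membership.Propositional using (_∈_)
open import Data.List.Relation.Unary.Unique.Propositional using (Unique)
open import Data.Product using (Σ; _×_; ∃; ∃-syntax)
open import Relation.Nullary using (¬_)
open import Relation.Binary.PropositionalEquality using (_≡_)
open import Function.Bundles using (_⇔_)

ℤ→ℚ : ℤ → ℚ
ℤ→ℚ z = z ℚ./ 1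

ℕ→ℚ : ℕ → ℚ
ℕ→ℚ n = ℤ→ℚ (+ n)

Σℚ : ∀ {k} → (Fin k → ℚ) → ℚ
Σℚ {zero}  f = 0ℚ
Σℚ {suc k} f = f zero + Σℚ (λ i → f (suc i))

_^ℚ_ : ℚ → ℕ → ℚ
q ^ℚ zero  = 1ℚ
q ^ℚ suc k = q * (q ^ℚ k)

Pt : ℕ → Set
Pt d = Fin d → ℤ

-- A lattice polytope P = conv{v_0,…,v_m} ⊂ ℝ^d given by finitely many
-- (m+1 ≥ 1) lattice points.  x ∈ ℤ^d lies in nP iff x = n·Σ λ_i v_i for a
-- convex combination λ (rational weights suffice since data is rational).
InDilate : ∀ {d m} → (Fin (suc m) → Pt d) → ℕ → Pt d → Set
InDilate {d} {m} v n x =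
  ∃[ λ' ] ((∀ i → 0ℚ ≤ λ' i) × (Σℚ λ' ≡ 1ℚ) ×
           (∀ j → ℤ→ℚ (x j) ≡ ℕ→ℚ n * Σℚ (λ i → λ' i * ℤ→ℚ (v i j))))

-- x ∈ n·relint(P): relint conv{v_i} = strictly positive convex combinations
InDilateRelint : ∀ {d m} → (Fin (suc m) → Pt d) → ℕ → Pt d → Set
InDilateRelint {d} {m} v n x =
  ∃[ λ' ] ((∀ i → 0ℚ < λ' i) × (Σℚ λ' ≡ 1ℚ) ×
           (∀ j → ℤ→ℚ (x j) ≡ ℕ→ℚ n * Σℚ (λ i → λ' i * ℤ→ℚ (v i j))))

AffInd : ∀ {d k} → (Fin (suc k) → Pt d) → Set
AffInd {d} {k} p =
  ∀ (μ : Fin (suc k) → ℚ) → Σℚ μ ≡ 0ℚ →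
    (∀ j → Σℚ (λ i → μ i * ℤ→ℚ (p i j)) ≡ 0ℚ) → ∀ i → μ i ≡ 0ℚ

Dim : ∀ {d m} → (Fin (suc m) → Pt d) → ℕ → Set
Dim {d} {m} v r =
  (Σ (Fin (suc r) → Fin (suc m)) λ f → AffInd {d} {r} (λ (i : Fin (suc r)) → v (f i))) ×
  (∀ (g : Fin (suc (suc r)) → Fin (suc m)) → ¬ AffInd (λ i → v (g i)))

Vec→Pt : ∀ {d} → Vec ℤ d → Pt d
Vec→Pt = Vec.lookup

HasCard : ∀ {d} → (Pt d → Set) → ℕ → Set
HasCard {d} S k =
  ∃[ L ] (Unique {A = Vec ℤ d} L × (∀ x → (x ∈ L) ⇔ S (Vec→Pt x)) × (length L ≡ k))

gcdPt : ∀ {d} → Pt d → ℕ → ℕ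
gcdPt {zero}  a n = n
gcdPt {suc d} a n = gcd ∣ a zero ∣ (gcdPt (λ j → a (suc j)) n)

CESet : ∀ {d} → (ℕ → Pt d → Set) → ℕ → Pt d → Set
CESet S n x = S n x × (gcdPt x n ≡ 1)

tuples : (k n : ℕ) → List (Vec ℕ k)
tuples zero    n = [] ∷ []
tuples (suc k) n = concatMap (λ a → map (a ∷_) (tuples k n)) (List.map suc (List.upTo n))

gcdVec : ∀ {k} → Vec ℕ k → ℕ → ℕ
gcdVec []       n = n
gcdVec (a ∷ as) n = gcd a (gcdVec as n)

J : ℕ → ℕ → ℕ
J k n = length (filter (λ t → gcdVec t n ℕ.≟ 1) (tuples k n))

IsEhrhart : ∀ {d m} → (Fin (suc m) → Pt d) → (r : ℕ) → (Fin (suc r) → ℚ) → Set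
IsEhrhart v r e =
  ∀ n k → HasCard (InDilate v n) k →
    Σℚ (λ i → e i * (ℕ→ℚ n ^ℚ Data.Fin.toℕ i)) ≡ ℕ→ℚ k

CEneg : ∀ {r} → (Fin (suc r) → ℚ) → ℕ → ℚ
CEneg e n = Σℚ (λ i → e i * (((- 1ℚ) ^ℚ Data.Fin.toℕ i) * ℕ→ℚ (J (Data.Fin.toℕ i) n)))

{-# OPTIONS --safe #-}
module Submission where

-- Homogenise the generators to vectors (1 , vᵢ) and let C be their cone, C° its interior and ρ = r + 1
-- its rank.  With the difference operators (∇_v g)(y) = g(y) − g(y − v), the function
-- s(y) = [y ∈ C] − (−1)^ρ [−y ∈ C°] is annihilated by the product of all the ∇_{(1 , vᵢ)}.
-- Indeed, for the cone over one more generator v, both terms are Euler integrals over t of the terms for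
-- the smaller cone at y − t v, weighted by [t ≥ 0] and by [t ≥ 0] − 1 respectively; hence
-- ∇_v turns the new s into the Euler integral over 0 ≤ t < 1 of the old s(y − t v), and induction
-- applies.  The Euler integrals make sense because Fourier–Motzkin elimination describes C and C°
-- by one and the same list of linear equations and (weak, resp. strict) inequalities.
--
-- Summing s over the lattice points of height n gives a function G : ℤ → ℚ killed by a power of the
-- difference operator; it counts nP for n > 0 and, up to the sign (−1)^r, (−n) relint P for n < 0.
-- It therefore agrees with the Ehrhart polynomial on all of ℤ, which is Ehrhart–Macdonald reciprocity.
-- Sorting points by their gcd with n shows that n ↦ |n relint P ∩ ℤ^d| and n ↦ n^k are the divisor
-- sums of CE(relint P ; –) and of J_k, and divisor sums determine their summands.

open import Defs
open import Level using (0ℓ)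
open import Data.Fin as Fin using (Fin; zero; suc; toℕ; _↑ʳ_; punchIn; punchOut)
import Data.Fin.Properties as FinP
open import Data.Integer as ℤ using (ℤ; 0ℤ; 1ℤ; ∣_∣)
import Data.Integer.Divisibility.Signed as Signed
import Data.Integer.Properties as ℤP
open import Data.Integer.Tactic.RingSolver using () renaming (solve-∀ to solve-ℤ)
open import Data.List as List using (List; []; _∷_; _++_; map; length; filter; upTo; concatMap; cartesianProductWith)
open import Data.List.Membership.Propositional using (_∈_; find)
open import Data.List.Membership.Propositional.Properties using (∈-map⁺; ∈-map⁻; ∈-++⁺ˡ; ∈-++⁺ʳ; ∈-filter⁺; ∈-filter⁻; ∈-tabulate⁺; ∈-upTo⁺; ∈-upTo⁻; ∈-deduplicate⁺; ∈-cartesianProductWith⁺; ∈-cartesianProductWith⁻)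
import Data.List.Properties as ListP
open import Data.List.Relation.Unary.All as All using (All; []; _∷_)
import Data.List.Relation.Unary.All.Properties as AllP
open import Data.List.Relation.Unary.AllPairs using ([]; _∷_)
open import Data.List.Relation.Unary.Any using (here; there)
import Data.List.Relation.Unary.Unique.DecPropositional.Properties as UniqueDec
open import Data.List.Relation.Unary.Unique.Propositional using (Unique)
import Data.List.Relation.Unary.Unique.Propositional.Properties as UniqueP
open import Data.Nat as ℕ using (ℕ; zero; suc; z≤n; s≤s; _≥_)
import Data.Nat.Coprimality as Coprimality
open import Data.Nat.Divisibility using (_∣_; _∣?_; divides; ∣-trans; ∣⇒≤; ∣-refl)
open import Data.Nat.GCD using (gcd; gcd[m,n]∣m; gcd[m,n]∣n; c*gcd[m,n]≡gcd[cm,cn])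
open import Data.Nat.Induction using (<-rec)
import Data.Nat.Properties as ℕP
open import Data.Product using (Σ; _×_; _,_; ∃-syntax; proj₁; proj₂)
open import Data.Rational as ℚ using (ℚ; 0ℚ; 1ℚ; _+_; _*_; _-_; -_; _≤_; _<_; 1/_; ≢-nonZero; mkℚ)
import Data.Rational.Properties as ℚP
open import Data.Sum as Sum using (_⊎_; inj₁; inj₂)
open import Data.Unit using (⊤; tt)
open import Data.Vec as Vec using (Vec; []; _∷_; lookup)
import Data.Vec.Properties as VecP
open import Function.Base using (_∘_)
open import Function.Bundles using (_⇔_; mk⇔; Equivalence)
open import Relation.Binary.Definitions using (DecidableEquality; tri<; tri≈; tri>)
open import Relation.Binary.PropositionalEquality hiding (J)
open import Relation.Nullary using (¬_; Dec; yes; no; contradiction)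
open import Relation.Nullary.Decidable using (dec⇒maybe; map′; _×-dec_)
open import Tactic.RingSolver using (solve-∀)
open import Tactic.RingSolver.Core.AlmostCommutativeRing using (AlmostCommutativeRing; fromCommutativeRing)

open ≡-Reasoning

-- Generators may repeat or lie inside the polytope, so the induction runs over generators and not
-- over faces. Adding a generator sweeps the old cone along a ray, and membership in P and in relint
-- P both have this form, with weights ≥ 0 and > 0. The sweep needs a measure for which a single
-- point and a closed interval both count 1; the Euler characteristic does this. For open fibres it
-- gives 1 for a point and -1 for an interval. So the sign (-1)^ρ changes exactly when the new
-- generator enlarges the span. The weights [t ≥ 0] and [t ≥ 0] - 1 differ by a constant, which
-- cancels when a translate is subtracted: both terms keep the same factor. The second weight lives
-- on t < 0, matching the passage from y to -y. Fibres must be bounded, because a closed ray has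
-- Euler characteristic 0. The common height 1 of the generators ensures this. Explicit linear
-- constraints also make membership decidable. This gives meaning to indicators, and it yields the
-- cardinalities to which the Ehrhart hypothesis is applied: dilates are found by testing the points
-- of a box.

ℚ-ring : AlmostCommutativeRing 0ℓ 0ℓ
ℚ-ring = fromCommutativeRing ℚP.+-*-commutativeRing (λ x → dec⇒maybe (0ℚ ℚP.≟ x))

-- Sums over lists

module _ {A : Set} where

  ∑ : (A → ℚ) → List A → ℚ
  ∑ f []      = 0ℚ
  ∑ f (x ∷ L) = f x + ∑ f L

  ∑-cong : ∀ {f g : A → ℚ} L → (∀ x → x ∈ L → f x ≡ g x) → ∑ f L ≡ ∑ g L
  ∑-cong []      eq = refl
  ∑-cong (x ∷ L) eq = cong₂ _+_ (eq x (here refl)) (∑-cong L (λ y y∈L → eq y (there y∈L)))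

  ∑-zero : ∀ {f : A → ℚ} L → (∀ x → x ∈ L → f x ≡ 0ℚ) → ∑ f L ≡ 0ℚ
  ∑-zero []      eq = refl
  ∑-zero (x ∷ L) eq = cong₂ _+_ (eq x (here refl)) (∑-zero L (λ y y∈L → eq y (there y∈L)))

  ∑-+ : ∀ (f g : A → ℚ) L → ∑ (λ x → f x + g x) L ≡ ∑ f L + ∑ g L
  ∑-+ f g []      = refl
  ∑-+ f g (x ∷ L) = trans (cong (f x + g x +_) (∑-+ f g L)) (lemma (f x) (g x) (∑ f L) (∑ g L))
    where
    lemma : ∀ a b c d → (a + b) + (c + d) ≡ (a + c) + (b + d)
    lemma = solve-∀ ℚ-ring

  ∑-* : ∀ c (f : A → ℚ) L → ∑ (λ x → c * f x) L ≡ c * ∑ f L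
  ∑-* c f []      = sym (ℚP.*-zeroʳ c)
  ∑-* c f (x ∷ L) = trans (cong (c * f x +_) (∑-* c f L)) (sym (ℚP.*-distribˡ-+ c (f x) (∑ f L)))

  ∑-++ : ∀ (f : A → ℚ) K L → ∑ f (K ++ L) ≡ ∑ f K + ∑ f L
  ∑-++ f []      L = sym (ℚP.+-identityˡ (∑ f L))
  ∑-++ f (x ∷ K) L = trans (cong (f x +_) (∑-++ f K L)) (sym (ℚP.+-assoc (f x) (∑ f K) (∑ f L)))

∑-map : ∀ {A B : Set} (g : B → A) (f : A → ℚ) L → ∑ f (map g L) ≡ ∑ (f ∘ g) L
∑-map g f []      = refl
∑-map g f (x ∷ L) = cong (f (g x) +_) (∑-map g f L)

∑-swap : ∀ {A B : Set} (f : A → B → ℚ) K L →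
  ∑ (λ x → ∑ (f x) L) K ≡ ∑ (λ y → ∑ (λ x → f x y) K) L
∑-swap f []      L = sym (∑-zero L (λ _ _ → refl))
∑-swap f (x ∷ K) L =
  trans (cong (∑ (f x) L +_) (∑-swap f K L)) (sym (∑-+ (f x) (λ y → ∑ (λ z → f z y) K) L))

ind : ∀ {P : Set} → Dec P → ℚ
ind (yes _) = 1ℚ
ind (no  _) = 0ℚ

ind-yes : ∀ {P : Set} (P? : Dec P) → P → ind P? ≡ 1ℚ
ind-yes (yes _) p = refl
ind-yes (no ¬p) p = contradiction p ¬p

ind-no : ∀ {P : Set} (P? : Dec P) → ¬ P → ind P? ≡ 0ℚ
ind-no (yes p) ¬p = contradiction p ¬p
ind-no (no _)  ¬p = refl

ind-cong : ∀ {P Q : Set} (P? : Dec P) (Q? : Dec Q) → (P → Q) → (Q → P) → ind P? ≡ ind Q?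
ind-cong (yes p) Q? f g = sym (ind-yes Q? (f p))
ind-cong (no ¬p) Q? f g = sym (ind-no Q? (¬p ∘ g))

ind-× : ∀ {P Q : Set} (P? : Dec P) (Q? : Dec Q) → ind P? * ind Q? ≡ ind (P? ×-dec Q?)
ind-× (yes p) (yes q) = refl
ind-× (yes p) (no ¬q) = refl
ind-× (no ¬p) Q?      = ℚP.*-zeroˡ (ind Q?)

module _ {A : Set} (_≟_ : DecidableEquality A) where

  ∑-point : ∀ {L} → Unique L → ∀ {x} → x ∈ L → ∑ (λ y → ind (x ≟ y)) L ≡ 1ℚ
  ∑-point (y∉L ∷ uL) {x} (here refl) =
    cong₂ _+_ (ind-yes (x ≟ x) refl) (∑-zero _ (λ z z∈L → ind-no (x ≟ z) (All.lookup y∉L z∈L)))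
  ∑-point (y∉L ∷ uL) {x} (there x∈L) =
    cong₂ _+_ (ind-no (x ≟ _) (λ { refl → All.lookup y∉L x∈L refl })) (∑-point uL x∈L)

  -- Each sum expands into a double sum over K and L with the factor [x = y]: where f x is nonzero,
  -- exactly one y meets x. On the diagonal f x and f y agree, so exchanging the order of summation
  -- turns one expansion into the other.
  ∑-support : ∀ {K L} → Unique K → Unique L → (f : A → ℚ) →
    (∀ x → x ∈ K → x ∈ L ⊎ f x ≡ 0ℚ) → (∀ x → x ∈ L → x ∈ K ⊎ f x ≡ 0ℚ) → ∑ f K ≡ ∑ f L
  ∑-support {K} {L} uK uL f K⊆L L⊆K = begin
    ∑ f K                                          ≡⟨ expand uL K⊆L ⟩
    ∑ (λ x → ∑ (λ y → f x * ind (x ≟ y)) L) K      ≡⟨ ∑-swap (λ x y → f x * ind (x ≟ y)) K L ⟩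
    ∑ (λ y → ∑ (λ x → f x * ind (x ≟ y)) K) L      ≡⟨ ∑-cong L (λ y _ → ∑-cong K (λ x _ → flip x y)) ⟩
    ∑ (λ y → ∑ (λ x → f y * ind (y ≟ x)) K) L      ≡⟨ expand uK L⊆K ⟨
    ∑ f L                                          ∎
    where
    flip : ∀ x y → f x * ind (x ≟ y) ≡ f y * ind (y ≟ x)
    flip x y with x ≟ y
    ... | yes refl = cong (f x *_) (sym (ind-yes (x ≟ x) refl))
    ... | no  x≢y  = trans (ℚP.*-zeroʳ (f x))
                       (sym (trans (cong (f y *_) (ind-no (y ≟ x) (x≢y ∘ sym))) (ℚP.*-zeroʳ (f y))))
    point : ∀ {L} → Unique L → ∀ x → x ∈ L ⊎ f x ≡ 0ℚ → f x ≡ ∑ (λ y → f x * ind (x ≟ y)) L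
    point {L} uL x (inj₁ x∈L) = sym (trans (∑-* (f x) _ L)
      (trans (cong (f x *_) (∑-point uL x∈L)) (ℚP.*-identityʳ (f x))))
    point {L} uL x (inj₂ fx≡0) = trans fx≡0 (sym (∑-zero L (λ y _ →
      trans (cong (_* ind (x ≟ y)) fx≡0) (ℚP.*-zeroˡ (ind (x ≟ y))))))
    expand : ∀ {K L} → Unique L → (∀ x → x ∈ K → x ∈ L ⊎ f x ≡ 0ℚ) →
      ∑ f K ≡ ∑ (λ x → ∑ (λ y → f x * ind (x ≟ y)) L) K
    expand {K} uL K⊆L = ∑-cong K (λ x x∈K → point uL x (K⊆L x x∈K))

  -- The sum of a finitely supported function over the whole type. The list only has to cover the
  -- support, so two functions can be summed over a common list.
  HasSum : (A → ℚ) → ℚ → Set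
  HasSum f c = ∃[ L ] (Unique L × (∀ x → x ∈ L ⊎ f x ≡ 0ℚ) × ∑ f L ≡ c)

  hasSum-unique : ∀ {f c c′} → HasSum f c → HasSum f c′ → c ≡ c′
  hasSum-unique {f} (K , uK , sK , refl) (L , uL , sL , refl) =
    ∑-support uK uL f (λ x _ → sL x) (λ x _ → sK x)

  hasSum-cong : ∀ {f g c} → (∀ x → f x ≡ g x) → HasSum f c → HasSum g c
  hasSum-cong f≗g (L , uL , sL , eq) =
    L , uL , (λ x → Sum.map₂ (trans (sym (f≗g x))) (sL x)) ,
    trans (∑-cong L (λ x _ → sym (f≗g x))) eq

  hasSum-+ : ∀ {f g a b} → HasSum f a → HasSum g b → HasSum (λ x → f x + g x) (a + b)
  hasSum-+ {f} {g} (K , uK , sK , refl) (L , uL , sL , refl) =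
    M , uM , sM , trans (∑-+ f g M) (cong₂ _+_
      (∑-support uM uK f (λ x _ → sK x) (λ x x∈K → inj₁ (∈-deduplicate⁺ _≟_ (∈-++⁺ˡ x∈K))))
      (∑-support uM uL g (λ x _ → sL x) (λ x x∈L → inj₁ (∈-deduplicate⁺ _≟_ (∈-++⁺ʳ K x∈L)))))
    where
    M : List A
    M = List.deduplicate _≟_ (K ++ L)
    uM : Unique M
    uM = UniqueDec.deduplicate-! _≟_ (K ++ L)
    sM : ∀ x → x ∈ M ⊎ f x + g x ≡ 0ℚ
    sM x with sK x | sL x
    ... | inj₁ x∈K | _        = inj₁ (∈-deduplicate⁺ _≟_ (∈-++⁺ˡ x∈K))
    ... | inj₂ _   | inj₁ x∈L = inj₁ (∈-deduplicate⁺ _≟_ (∈-++⁺ʳ K x∈L))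
    ... | inj₂ p   | inj₂ q   = inj₂ (cong₂ _+_ p q)

  hasSum-* : ∀ {f a} c → HasSum f a → HasSum (λ x → c * f x) (c * a)
  hasSum-* {f} c (L , uL , sL , refl) =
    L , uL , (λ x → Sum.map₂ (λ p → trans (cong (c *_) p) (ℚP.*-zeroʳ c)) (sL x)) , ∑-* c f L

  hasSum-zero : ∀ {f c} → (∀ x → f x ≡ 0ℚ) → HasSum f c → c ≡ 0ℚ
  hasSum-zero f≗0 (L , _ , _ , refl) = ∑-zero L (λ x _ → f≗0 x)

-- Order on ℚ and extrema of finite lists

p≤q⇒0≤q-p : ∀ {p q} → p ≤ q → 0ℚ ≤ q - p
p≤q⇒0≤q-p {p} {q} p≤q = subst (_≤ q - p) (ℚP.+-inverseʳ p) (ℚP.+-monoˡ-≤ (- p) p≤q)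

0≤q-p⇒p≤q : ∀ {p q} → 0ℚ ≤ q - p → p ≤ q
0≤q-p⇒p≤q {p} {q} h = subst₂ _≤_ (ℚP.+-identityˡ p) (lemma q p) (ℚP.+-monoˡ-≤ p h)
  where
  lemma : ∀ q p → (q - p) + p ≡ q
  lemma = solve-∀ ℚ-ring

p<q⇒0<q-p : ∀ {p q} → p < q → 0ℚ < q - p
p<q⇒0<q-p {p} {q} p<q = subst (_< q - p) (ℚP.+-inverseʳ p) (ℚP.+-monoˡ-< (- p) p<q)

0<q-p⇒p<q : ∀ {p q} → 0ℚ < q - p → p < q
0<q-p⇒p<q {p} {q} h = subst₂ _<_ (ℚP.+-identityˡ p) (lemma q p) (ℚP.+-monoˡ-< p h)
  where
  lemma : ∀ q p → (q - p) + p ≡ q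
  lemma = solve-∀ ℚ-ring

0<1 : 0ℚ < 1ℚ
0<1 = ℚP.positive⁻¹ 1ℚ

q<q+1 : ∀ q → q < q + 1ℚ
q<q+1 q = subst (_< q + 1ℚ) (ℚP.+-identityʳ q) (ℚP.+-monoʳ-< q 0<1)

maximum : ∀ l L → ∃[ a ] (a ∈ l ∷ L × All (_≤ a) (l ∷ L))
maximum l []      = l , here refl , ℚP.≤-refl ∷ []
maximum l (k ∷ L) with maximum k L
... | a , a∈ , ub with ℚP.≤-total l a
...   | inj₁ l≤a = a , there a∈ , l≤a ∷ ub
...   | inj₂ a≤l = l , here refl , ℚP.≤-refl ∷ All.map (λ x≤a → ℚP.≤-trans x≤a a≤l) ub

minimum : ∀ l L → ∃[ a ] (a ∈ l ∷ L × All (a ≤_) (l ∷ L))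
minimum l []      = l , here refl , ℚP.≤-refl ∷ []
minimum l (k ∷ L) with minimum k L
... | a , a∈ , lb with ℚP.≤-total a l
...   | inj₁ a≤l = a , there a∈ , a≤l ∷ lb
...   | inj₂ l≤a = l , here refl , ℚP.≤-refl ∷ All.map (λ a≤x → ℚP.≤-trans l≤a a≤x) lb

-- The Euler integral of a step function on ℚ

-- (a , c) stands for c·[t ≥ a] in the first list and for c·[t > a] in the second.
Steps : Set
Steps = List (ℚ × ℚ) × List (ℚ × ℚ)

closedRay openRay endpoint : ℚ → ℚ × ℚ → ℚ
closedRay t (a , c) = c * ind (a ℚP.≤? t)
openRay   t (a , c) = c * ind (a ℚP.<? t)
endpoint  t (a , c) = c * ind (t ℚP.≟ a)

⟦_⟧ : Steps → ℚ → ℚ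
⟦ A , B ⟧ t = ∑ (closedRay t) A + ∑ (openRay t) B

-- A closed ray has Euler characteristic (with compact support) 0, an open ray −1.
χ : Steps → ℚ
χ (A , B) = - ∑ proj₂ B

-- The value is read off from one representation of f by rays. That it depends on f alone follows
-- from `euler-zero`, applied to the difference of two representations.
EulerIntegral : (ℚ → ℚ) → ℚ → Set
EulerIntegral f c = ∃[ s ] ((∀ t → f t ≡ ⟦ s ⟧ t) × c ≡ χ s)

euler-cong : ∀ {f g c} → (∀ t → f t ≡ g t) → EulerIntegral f c → EulerIntegral g c
euler-cong f≗g (s , f≗s , eq) = s , (λ t → trans (sym (f≗g t)) (f≗s t)) , eq

euler-+ : ∀ {f g a b} → EulerIntegral f a → EulerIntegral g b → EulerIntegral (λ t → f t + g t) (a + b)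
euler-+ {f} {g} ((A , B) , p , refl) ((A′ , B′) , p′ , refl) =
  (A ++ A′ , B ++ B′) , eq , trans (sym (ℚP.neg-distrib-+ (∑ proj₂ B) (∑ proj₂ B′))) (cong -_ (sym (∑-++ proj₂ B B′)))
  where
  lemma : ∀ a b c d → (a + b) + (c + d) ≡ (a + c) + (b + d)
  lemma = solve-∀ ℚ-ring
  eq : ∀ t → f t + g t ≡ ⟦ A ++ A′ , B ++ B′ ⟧ t
  eq t = begin
    f t + g t  ≡⟨ cong₂ _+_ (p t) (p′ t) ⟩
    (∑ (closedRay t) A + ∑ (openRay t) B) + (∑ (closedRay t) A′ + ∑ (openRay t) B′)
      ≡⟨ lemma (∑ (closedRay t) A) _ _ _ ⟩
    (∑ (closedRay t) A + ∑ (closedRay t) A′) + (∑ (openRay t) B + ∑ (openRay t) B′)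
      ≡⟨ cong₂ _+_ (∑-++ (closedRay t) A A′) (∑-++ (openRay t) B B′) ⟨
    ⟦ A ++ A′ , B ++ B′ ⟧ t ∎

euler-* : ∀ {f a} k → EulerIntegral f a → EulerIntegral (λ t → k * f t) (k * a)
euler-* {f} k ((A , B) , p , refl) = (map scale A , map scale B) , eq ,
  trans (sym (ℚP.neg-distribʳ-* k (∑ proj₂ B)))
    (cong -_ (sym (trans (∑-map scale proj₂ B) (∑-* k proj₂ B))))
  where
  scale : ℚ × ℚ → ℚ × ℚ
  scale (a , c) = a , k * c
  scaled : ∀ (ray : ℚ × ℚ → ℚ) → (∀ x → ray (scale x) ≡ k * ray x) → ∀ L → ∑ ray (map scale L) ≡ k * ∑ ray L
  scaled ray h L = trans (∑-map scale ray L) (trans (∑-cong L (λ x _ → h x)) (∑-* k ray L))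
  eq : ∀ t → k * f t ≡ ⟦ map scale A , map scale B ⟧ t
  eq t = begin
    k * f t                                        ≡⟨ cong (k *_) (p t) ⟩
    k * (∑ (closedRay t) A + ∑ (openRay t) B)      ≡⟨ ℚP.*-distribˡ-+ k _ _ ⟩
    k * ∑ (closedRay t) A + k * ∑ (openRay t) B    ≡⟨ cong₂ _+_
      (scaled (closedRay t) (λ { (a , c) → ℚP.*-assoc k c _ }) A)
      (scaled (openRay t) (λ { (a , c) → ℚP.*-assoc k c _ }) B) ⟨
    ⟦ map scale A , map scale B ⟧ t                ∎

euler-shift : ∀ {f a} u → EulerIntegral f a → EulerIntegral (λ t → f (t - u)) a
euler-shift {f} u ((A , B) , p , refl) = (map shift A , map shift B) , eq ,
  cong -_ (sym (∑-map shift proj₂ B))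
  where
  shift : ℚ × ℚ → ℚ × ℚ
  shift (a , c) = a + u , c
  lemma : ∀ a t u → (t - u) - a ≡ t - (a + u)
  lemma = solve-∀ ℚ-ring
  le : ∀ a t → a ≤ t - u → a + u ≤ t
  le a t h = 0≤q-p⇒p≤q (subst (0ℚ ≤_) (lemma a t u) (p≤q⇒0≤q-p h))
  le′ : ∀ a t → a + u ≤ t → a ≤ t - u
  le′ a t h = 0≤q-p⇒p≤q (subst (0ℚ ≤_) (sym (lemma a t u)) (p≤q⇒0≤q-p h))
  lt : ∀ a t → a < t - u → a + u < t
  lt a t h = 0<q-p⇒p<q (subst (0ℚ <_) (lemma a t u) (p<q⇒0<q-p h))
  lt′ : ∀ a t → a + u < t → a < t - u
  lt′ a t h = 0<q-p⇒p<q (subst (0ℚ <_) (sym (lemma a t u)) (p<q⇒0<q-p h))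
  eq : ∀ t → f (t - u) ≡ ⟦ map shift A , map shift B ⟧ t
  eq t = trans (p (t - u)) (sym (cong₂ _+_
    (trans (∑-map shift (closedRay t) A) (∑-cong A (λ { (a , c) _ →
      cong (c *_) (ind-cong (a + u ℚP.≤? t) (a ℚP.≤? t - u) (le′ a t) (le a t)) })))
    (trans (∑-map shift (openRay t) B) (∑-cong B (λ { (a , c) _ →
      cong (c *_) (ind-cong (a + u ℚP.<? t) (a ℚP.<? t - u) (lt′ a t) (lt a t)) })))))

-- The interval is [a, ∞) minus (b, ∞). The case a = b is included, so a point also has value 1.
euler-closed : ∀ {a b} {P : ℚ → Set} (P? : ∀ t → Dec (P t)) → a ≤ b →
  (∀ t → P t → a ≤ t × t ≤ b) → (∀ t → a ≤ t → t ≤ b → P t) → EulerIntegral (ind ∘ P?) 1ℚ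
euler-closed {a} {b} P? a≤b to from = ((a , 1ℚ) ∷ [] , (b , - 1ℚ) ∷ []) , eq , refl
  where
  eq : ∀ t → ind (P? t) ≡ ⟦ (a , 1ℚ) ∷ [] , (b , - 1ℚ) ∷ [] ⟧ t
  eq t with a ℚP.≤? t | b ℚP.<? t
  ... | yes a≤t | yes b<t = ind-no (P? t) (λ p → ℚP.<-irrefl refl (ℚP.<-≤-trans b<t (proj₂ (to t p))))
  ... | yes a≤t | no  b≮t = ind-yes (P? t) (from t a≤t (ℚP.≮⇒≥ b≮t))
  ... | no  a≰t | yes b<t = contradiction (ℚP.≤-trans a≤b (ℚP.<⇒≤ b<t)) a≰t
  ... | no  a≰t | no  b≮t = ind-no (P? t) (a≰t ∘ proj₁ ∘ to t)

-- The interval is (a, ∞) minus [b, ∞), and only the open ray contributes, with -1.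
euler-open : ∀ {a b} {P : ℚ → Set} (P? : ∀ t → Dec (P t)) → a < b →
  (∀ t → P t → a < t × t < b) → (∀ t → a < t → t < b → P t) → EulerIntegral (ind ∘ P?) (- 1ℚ)
euler-open {a} {b} P? a<b to from = ((b , - 1ℚ) ∷ [] , (a , 1ℚ) ∷ []) , eq , refl
  where
  eq : ∀ t → ind (P? t) ≡ ⟦ (b , - 1ℚ) ∷ [] , (a , 1ℚ) ∷ [] ⟧ t
  eq t with b ℚP.≤? t | a ℚP.<? t
  ... | yes b≤t | yes a<t = ind-no (P? t) (λ p → ℚP.<-irrefl refl (ℚP.<-≤-trans (proj₂ (to t p)) b≤t))
  ... | no  b≰t | yes a<t = ind-yes (P? t) (from t a<t (ℚP.≰⇒> b≰t))
  ... | yes b≤t | no  a≮t = contradiction (ℚP.<-≤-trans a<b b≤t) a≮t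
  ... | no  b≰t | no  a≮t = ind-no (P? t) (a≮t ∘ proj₁ ∘ to t)

euler-empty : ∀ {f} → (∀ t → f t ≡ 0ℚ) → EulerIntegral f 0ℚ
euler-empty f≗0 = ([] , []) , f≗0 , refl

-- Provides right-hand limits: a step function with all its breakpoints in L is constant on (b, t].
next-gap : ∀ b L → ∃[ t ] (b < t × All (λ a → b < a → t < a) L)
next-gap b []      = b + 1ℚ , q<q+1 b , []
next-gap b (a ∷ L) with next-gap b L | b ℚP.<? a
... | t , b<t , gap | no  b≮a = t , b<t , (λ b<a → contradiction b<a b≮a) ∷ gap
... | t , b<t , gap | yes b<a with ℚP.<-cmp t a
...   | tri< t<a _ _ = t , b<t , (λ _ → t<a) ∷ gap
...   | tri≈ _ refl _ with ℚP.<-dense b<a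
...     | c , b<c , c<a = c , b<c , (λ _ → c<a) ∷ All.map (λ h b<x → ℚP.<-trans c<a (h b<x)) gap
next-gap b (a ∷ L) | t , b<t , gap | yes b<a | tri> _ _ a<t with ℚP.<-dense b<a
...     | c , b<c , c<a = c , b<c , (λ _ → c<a) ∷ All.map (λ h b<x → ℚP.<-trans (ℚP.<-trans c<a a<t) (h b<x)) gap

-- The total weight of the open rays issuing from b is the jump of the step function just after b.
euler-jump : ∀ A B → (∀ t → ⟦ A , B ⟧ t ≡ 0ℚ) → ∀ b → ∑ (endpoint b) B ≡ 0ℚ
euler-jump A B zero-everywhere b with next-gap b (map proj₁ (A ++ B))
... | t , b<t , gap = begin
    ∑ (endpoint b) B
      ≡⟨ ∑-cong B (λ { (a , c) ac∈B → jump a c (All.lookup gap (∈-map⁺ proj₁ (∈-++⁺ʳ A ac∈B))) }) ⟩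
    ∑ (λ x → openRay t x + - 1ℚ * openRay b x) B
      ≡⟨ trans (∑-+ (openRay t) _ B) (cong (∑ (openRay t) B +_) (∑-* (- 1ℚ) (openRay b) B)) ⟩
    ∑ (openRay t) B + - 1ℚ * ∑ (openRay b) B
      ≡⟨ lemma (∑ (closedRay t) A) _ _ ⟩
    (∑ (closedRay t) A + ∑ (openRay t) B) - (∑ (closedRay t) A + ∑ (openRay b) B)
      ≡⟨ cong (λ z → ⟦ A , B ⟧ t - (z + ∑ (openRay b) B)) (∑-cong A (λ { (a , c) ac∈A →
           no-jump a c (All.lookup gap (∈-map⁺ proj₁ (∈-++⁺ˡ ac∈A))) })) ⟩
    ⟦ A , B ⟧ t - ⟦ A , B ⟧ b
      ≡⟨ cong₂ _-_ (zero-everywhere t) (zero-everywhere b) ⟩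
    0ℚ ∎
  where
  lemma : ∀ x y z → y + - 1ℚ * z ≡ (x + y) - (x + z)
  lemma = solve-∀ ℚ-ring
  no-jump : ∀ a c → (b < a → t < a) → closedRay t (a , c) ≡ closedRay b (a , c)
  no-jump a c h = cong (c *_) (ind-cong (a ℚP.≤? t) (a ℚP.≤? b)
    (λ a≤t → ℚP.≮⇒≥ (λ b<a → ℚP.<-irrefl refl (ℚP.<-≤-trans (h b<a) a≤t)))
    (λ a≤b → ℚP.≤-trans a≤b (ℚP.<⇒≤ b<t)))
  jump : ∀ a c → (b < a → t < a) → endpoint b (a , c) ≡ openRay t (a , c) + - 1ℚ * openRay b (a , c)
  jump a c h with ℚP.<-cmp a b
  ... | tri< a<b a≢b _
    rewrite ind-no (b ℚP.≟ a) (a≢b ∘ sym) | ind-yes (a ℚP.<? t) (ℚP.<-trans a<b b<t) | ind-yes (a ℚP.<? b) a<b = eq c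
    where
    eq : ∀ c → c * 0ℚ ≡ c * 1ℚ + - 1ℚ * (c * 1ℚ)
    eq = solve-∀ ℚ-ring
  ... | tri≈ a≮b refl _
    rewrite ind-yes (b ℚP.≟ b) refl | ind-yes (b ℚP.<? t) b<t | ind-no (b ℚP.<? b) a≮b = eq c
    where
    eq : ∀ c → c * 1ℚ ≡ c * 1ℚ + - 1ℚ * (c * 0ℚ)
    eq = solve-∀ ℚ-ring
  ... | tri> a≮b a≢b b<a
    rewrite ind-no (b ℚP.≟ a) (a≢b ∘ sym) | ind-no (a ℚP.<? t) (ℚP.<-asym (h b<a)) | ind-no (a ℚP.<? b) a≮b = eq c
    where
    eq : ∀ c → c * 0ℚ ≡ c * 0ℚ + - 1ℚ * (c * 0ℚ)
    eq = solve-∀ ℚ-ring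

-- Grouped by endpoint, the weights of the open rays add up to the jumps of the function, and the
-- zero function has none.
euler-zero : ∀ {f c} → (∀ t → f t ≡ 0ℚ) → EulerIntegral f c → c ≡ 0ℚ
euler-zero f≗0 ((A , B) , p , refl) = cong -_ (begin
    ∑ proj₂ B
      -- A weight c at a is spread over the distinct endpoints b as c · [b = a]; one term survives.
      ≡⟨ ∑-cong B (λ { (a , c) ac∈B → sym (trans (∑-* c _ L) (trans
           (cong (c *_) (trans (∑-cong L (λ b _ → ind-cong (b ℚP.≟ a) (a ℚP.≟ b) sym sym))
             (∑-point ℚP._≟_ uL (∈-deduplicate⁺ ℚP._≟_ (∈-map⁺ proj₁ ac∈B)))))
           (ℚP.*-identityʳ c))) }) ⟩
    ∑ (λ x → ∑ (λ b → endpoint b x) L) B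
      ≡⟨ ∑-swap (λ x b → endpoint b x) B L ⟩
    ∑ (λ b → ∑ (endpoint b) B) L
      ≡⟨ ∑-zero L (λ b _ → euler-jump A B (λ t → trans (sym (p t)) (f≗0 t)) b) ⟩
    0ℚ ∎)
  where
  L : List ℚ
  L = List.deduplicate ℚP._≟_ (map proj₁ B)
  uL : Unique L
  uL = UniqueDec.deduplicate-! ℚP._≟_ (map proj₁ B)

-- Vectors and linear functionals

Σℚ-cong : ∀ {k} {f g : Fin k → ℚ} → (∀ i → f i ≡ g i) → Σℚ f ≡ Σℚ g
Σℚ-cong {zero}  eq = refl
Σℚ-cong {suc k} eq = cong₂ _+_ (eq zero) (Σℚ-cong (eq ∘ suc))

Σℚ-zero : ∀ {k} {f : Fin k → ℚ} → (∀ i → f i ≡ 0ℚ) → Σℚ f ≡ 0ℚ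
Σℚ-zero {zero}  eq = refl
Σℚ-zero {suc k} eq = cong₂ _+_ (eq zero) (Σℚ-zero (eq ∘ suc))

Σℚ-+ : ∀ {k} (f g : Fin k → ℚ) → Σℚ (λ i → f i + g i) ≡ Σℚ f + Σℚ g
Σℚ-+ {zero}  f g = refl
Σℚ-+ {suc k} f g = trans (cong (f zero + g zero +_) (Σℚ-+ (f ∘ suc) (g ∘ suc)))
  (lemma (f zero) (g zero) (Σℚ (f ∘ suc)) (Σℚ (g ∘ suc)))
  where
  lemma : ∀ a b c d → (a + b) + (c + d) ≡ (a + c) + (b + d)
  lemma = solve-∀ ℚ-ring

Σℚ-*ˡ : ∀ {k} c (f : Fin k → ℚ) → Σℚ (λ i → c * f i) ≡ c * Σℚ f
Σℚ-*ˡ {zero}  c f = sym (ℚP.*-zeroʳ c)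
Σℚ-*ˡ {suc k} c f = trans (cong (c * f zero +_) (Σℚ-*ˡ c (f ∘ suc))) (sym (ℚP.*-distribˡ-+ c (f zero) _))

Σℚ-swap : ∀ {k l} (f : Fin k → Fin l → ℚ) → Σℚ (λ i → Σℚ (f i)) ≡ Σℚ (λ j → Σℚ (λ i → f i j))
Σℚ-swap {zero}  f = sym (Σℚ-zero {f = λ j → Σℚ (λ i → f i j)} (λ _ → refl))
Σℚ-swap {suc k} f = trans (cong (Σℚ (f zero) +_) (Σℚ-swap (f ∘ suc)))
  (sym (Σℚ-+ (f zero) (λ j → Σℚ (λ i → f (suc i) j))))

Vector : ℕ → Set
Vector D = Fin D → ℚ

infixl 6 _−[_]_

_−[_]_ : ∀ {D} → Vector D → ℚ → Vector D → Vector D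
(y −[ t ] v) j = y j - t * v j

neg : ∀ {D} → Vector D → Vector D
neg y j = - y j

dot : ∀ {D} → Vector D → Vector D → ℚ
dot a y = Σℚ (λ j → a j * y j)

dot-sub : ∀ {D} (a y : Vector D) t v → dot a (y −[ t ] v) ≡ dot a y - t * dot a v
dot-sub a y t v = begin
  Σℚ (λ j → a j * (y j - t * v j))                 ≡⟨ Σℚ-cong (λ j → lemma (a j) (y j) t (v j)) ⟩
  Σℚ (λ j → a j * y j + - t * (a j * v j))         ≡⟨ Σℚ-+ (λ j → a j * y j) _ ⟩
  dot a y + Σℚ (λ j → - t * (a j * v j))           ≡⟨ cong (dot a y +_) (Σℚ-*ˡ (- t) (λ j → a j * v j)) ⟩
  dot a y + - t * dot a v                          ≡⟨ cong (dot a y +_) (sym (ℚP.neg-distribˡ-* t _)) ⟩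
  dot a y - t * dot a v                            ∎
  where
  lemma : ∀ a y t v → a * (y - t * v) ≡ a * y + - t * (a * v)
  lemma = solve-∀ ℚ-ring

dot-subˡ : ∀ {D} (a b : Vector D) c y → dot (a −[ c ] b) y ≡ dot a y - c * dot b y
dot-subˡ a b c y = trans (Σℚ-cong (λ j → ℚP.*-comm (a j - c * b j) (y j)))
  (trans (dot-sub y a c b) (cong₂ (λ p q → p - c * q) (Σℚ-cong (λ j → ℚP.*-comm (y j) (a j)))
    (Σℚ-cong (λ j → ℚP.*-comm (y j) (b j)))))

_⊙_ : ∀ {D} → ℚ → Vector D → Vector D
(c ⊙ a) j = c * a j

dot-⊙ˡ : ∀ {D} c (a y : Vector D) → dot (c ⊙ a) y ≡ c * dot a y
dot-⊙ˡ c a y = trans (Σℚ-cong (λ j → ℚP.*-assoc c (a j) (y j))) (Σℚ-*ˡ c (λ j → a j * y j))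

dot-zeroˡ : ∀ {D} (y : Vector D) → dot (λ _ → 0ℚ) y ≡ 0ℚ
dot-zeroˡ y = Σℚ-zero (λ j → ℚP.*-zeroˡ (y j))

-- Nonnegative and positive numbers, treated simultaneously

record Positivity : Set₁ where
  field
    Pos     : ℚ → Set
    pos?    : ∀ q → Dec (Pos q)
    pos⇒≥0  : ∀ {q} → Pos q → 0ℚ ≤ q
    >0⇒pos  : ∀ {q} → 0ℚ < q → Pos q
    pos+≥0  : ∀ {p q} → Pos p → 0ℚ ≤ q → Pos (p + q)
    pos-*   : ∀ {c q} → 0ℚ < c → Pos q → Pos (c * q)
    -- This is what eliminating a variable asks of the order. Weak inequalities are met by the
    -- largest lower bound, strict ones by density. The lower list is nonempty because the
    -- coefficient t is itself bounded below by 0; upper bounds may be absent.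
    between : ∀ l L U → (∀ x y → x ∈ l ∷ L → y ∈ U → Pos (y - x)) →
              ∃[ t ] ((∀ x → x ∈ l ∷ L → Pos (t - x)) × (∀ y → y ∈ U → Pos (y - t)))

  pos-- : ∀ x y z → Pos (z - y) → Pos (y - x) → Pos (z - x)
  pos-- x y z p q = subst Pos (lemma x y z) (pos+≥0 p (pos⇒≥0 q))
    where
    lemma : ∀ x y z → (z - y) + (y - x) ≡ z - x
    lemma = solve-∀ ℚ-ring

  pos--≤ : ∀ x y z → y ≤ z → Pos (y - x) → Pos (z - x)
  pos--≤ x y z y≤z p = subst Pos (lemma x y z) (pos+≥0 p (p≤q⇒0≤q-p y≤z))
    where
    lemma : ∀ x y z → (y - x) + (z - y) ≡ z - x
    lemma = solve-∀ ℚ-ring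

  ≤-pos-- : ∀ x y z → x ≤ y → Pos (z - y) → Pos (z - x)
  ≤-pos-- x y z x≤y p = subst Pos (lemma x y z) (pos+≥0 p (p≤q⇒0≤q-p x≤y))
    where
    lemma : ∀ x y z → (z - y) + (y - x) ≡ z - x
    lemma = solve-∀ ℚ-ring

0<c⇒0<c*q : ∀ {c q} → 0ℚ < c → 0ℚ < q → 0ℚ < c * q
0<c⇒0<c*q {c} {q} c>0 q>0 = ℚP.positive⁻¹ (c * q)
  {{ℚP.pos*pos⇒pos c {{ℚ.positive c>0}} q {{ℚ.positive q>0}}}}

0≤c⇒0≤c*q : ∀ {c q} → 0ℚ ≤ c → 0ℚ ≤ q → 0ℚ ≤ c * q
0≤c⇒0≤c*q {c} {q} c≥0 q≥0 = ℚP.nonNegative⁻¹ (c * q)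
  {{ℚP.nonNeg*nonNeg⇒nonNeg c {{ℚ.nonNegative c≥0}} q {{ℚ.nonNegative q≥0}}}}

nonnegative : Positivity
nonnegative = record
  { Pos    = 0ℚ ≤_
  ; pos?   = 0ℚ ℚP.≤?_
  ; pos⇒≥0 = λ p → p
  ; >0⇒pos = ℚP.<⇒≤
  ; pos+≥0 = λ p q → ℚP.+-mono-≤ p q
  ; pos-*  = λ c>0 q≥0 → 0≤c⇒0≤c*q (ℚP.<⇒≤ c>0) q≥0
  ; between = λ l L U h → let (a , a∈ , ub) = maximum l L in
      a , (λ x x∈ → p≤q⇒0≤q-p (All.lookup ub x∈)) , (λ y y∈ → h a y a∈ y∈)
  }

positive : Positivity
positive = record
  { Pos    = 0ℚ <_
  ; pos?   = 0ℚ ℚP.<?_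
  ; pos⇒≥0 = ℚP.<⇒≤
  ; >0⇒pos = λ p → p
  ; pos+≥0 = λ p q → ℚP.+-mono-<-≤ p q
  ; pos-*  = 0<c⇒0<c*q
  ; between = strictly-between
  }
  where
  strictly-between : ∀ l L U → (∀ x y → x ∈ l ∷ L → y ∈ U → 0ℚ < y - x) →
    ∃[ t ] ((∀ x → x ∈ l ∷ L → 0ℚ < t - x) × (∀ y → y ∈ U → 0ℚ < y - t))
  strictly-between l L [] h =
    let (a , a∈ , ub) = maximum l L in
    a + 1ℚ , (λ x x∈ → p<q⇒0<q-p (ℚP.≤-<-trans (All.lookup ub x∈) (q<q+1 a))) , (λ _ ())
  strictly-between l L (u ∷ U) h =
    let (a , a∈ , ub) = maximum l L
        (b , b∈ , lb) = minimum u U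
        (t , a<t , t<b) = ℚP.<-dense (0<q-p⇒p<q (h a b a∈ b∈))
    in t , (λ x x∈ → p<q⇒0<q-p (ℚP.≤-<-trans (All.lookup ub x∈) a<t))
         , (λ y y∈ → p<q⇒0<q-p (ℚP.<-≤-trans t<b (All.lookup lb y∈)))

-- Cones and systems of linear constraints

module _ (P : Positivity) where
  open Positivity P

  -- One coefficient is split off at a time, so that the fibre over y along the first generator is
  -- by definition a cone over the remaining ones. The instance `positive` gives the relative
  -- interior.
  Cone : ∀ {D k} → (Fin k → Vector D) → Vector D → Set
  Cone {k = zero}  V y = ∀ j → y j ≡ 0ℚ
  Cone {k = suc k} V y = ∃[ t ] (Pos t × Cone (V ∘ suc) (y −[ t ] V zero))

  Solution : ∀ {D} → List (Vector D) → List (Vector D) → Vector D → Set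
  Solution E S y = All (λ ℓ → dot ℓ y ≡ 0ℚ) E × All (λ ℓ → Pos (dot ℓ y)) S

  solution? : ∀ {D} E S (y : Vector D) → Dec (Solution E S y)
  solution? E S y = All.all? (λ ℓ → dot ℓ y ℚP.≟ 0ℚ) E ×-dec All.all? (λ ℓ → pos? (dot ℓ y)) S

  Cone-resp : ∀ {D k} (V : Fin k → Vector D) {y z} → y ≗ z → Cone V y → Cone V z
  Cone-resp {k = zero}  V y≗z c j         = trans (sym (y≗z j)) (c j)
  Cone-resp {k = suc k} V y≗z (t , p , c) =
    t , p , Cone-resp (V ∘ suc) (λ j → cong (_- t * V zero j) (y≗z j)) c

-- How the constraints ℓ (y − t v) ∈ Pos bound t: from below by L, from above by U, not at all by Z.
data Bounds {D} (v : Vector D) : (S L U Z : List (Vector D)) → Set where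
  []    : Bounds v [] [] [] []
  above : ∀ {S L U Z ℓ c} → 0ℚ < dot ℓ v → 0ℚ < c → c * dot ℓ v ≡ 1ℚ →
          Bounds v S L U Z → Bounds v (ℓ ∷ S) L (c ⊙ ℓ ∷ U) Z
  below : ∀ {S L U Z ℓ c} → 0ℚ < - dot ℓ v → 0ℚ < - c → c * dot ℓ v ≡ 1ℚ →
          Bounds v S L U Z → Bounds v (ℓ ∷ S) (c ⊙ ℓ ∷ L) U Z
  free  : ∀ {S L U Z ℓ} → dot ℓ v ≡ 0ℚ → Bounds v S L U Z → Bounds v (ℓ ∷ S) L U (ℓ ∷ Z)

inverse : ∀ {q} → q ≢ 0ℚ → ∃[ c ] (c * q ≡ 1ℚ)
inverse {q} q≢0 = (1/ q) {{≢-nonZero q≢0}} , ℚP.*-inverseˡ q {{≢-nonZero q≢0}}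

inverse-pos : ∀ {q} → 0ℚ < q → ∃[ c ] (0ℚ < c × c * q ≡ 1ℚ)
inverse-pos {q} q>0 = 1/ q , ℚP.positive⁻¹ (1/ q) {{ℚP.1/pos⇒pos q}} , ℚP.*-inverseˡ q
  where instance
    _ = ℚ.positive q>0
    _ = ℚP.pos⇒nonZero q

bounds : ∀ {D} (v : Vector D) S → ∃[ L ] ∃[ U ] ∃[ Z ] Bounds v S L U Z
bounds v []      = [] , [] , [] , []
bounds v (ℓ ∷ S) with bounds v S | ℚP.<-cmp 0ℚ (dot ℓ v)
... | _ , _ , _ , B | tri< ℓv>0 _ _ =
  let (c , c>0 , inv) = inverse-pos ℓv>0 in _ , _ , _ , above ℓv>0 c>0 inv B
... | _ , _ , _ , B | tri≈ _ 0≡ℓv _ = _ , _ , _ , free (sym 0≡ℓv) B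
... | _ , _ , _ , B | tri> _ _ ℓv<0 =
  let -ℓv>0 = subst (_< - dot ℓ v) refl (ℚP.neg-antimono-< ℓv<0)
      (c , c>0 , inv) = inverse-pos -ℓv>0
  in _ , _ , _ , below { c = - c } -ℓv>0 (subst (0ℚ <_) (negneg c) c>0) (trans (lemma c (dot ℓ v)) inv) B
  where
  negneg : ∀ c → c ≡ - - c
  negneg = solve-∀ ℚ-ring
  lemma : ∀ c q → - c * q ≡ c * - q
  lemma = solve-∀ ℚ-ring

module _ (P : Positivity) where
  open Positivity P

  private
    upper : ∀ {D} (ℓ v y : Vector D) c t → c * dot ℓ v ≡ 1ℚ → c * dot ℓ (y −[ t ] v) ≡ dot (c ⊙ ℓ) y - t
    upper ℓ v y c t inv = begin
      c * dot ℓ (y −[ t ] v)              ≡⟨ cong (c *_) (dot-sub ℓ y t v) ⟩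
      c * (dot ℓ y - t * dot ℓ v)         ≡⟨ lemma c (dot ℓ y) t (dot ℓ v) ⟩
      c * dot ℓ y - t * (c * dot ℓ v)     ≡⟨ cong₂ (λ p q → p - t * q) (sym (dot-⊙ˡ c ℓ y)) inv ⟩
      dot (c ⊙ ℓ) y - t * 1ℚ              ≡⟨ cong (λ z → dot (c ⊙ ℓ) y - z) (ℚP.*-identityʳ t) ⟩
      dot (c ⊙ ℓ) y - t                   ∎
      where
      lemma : ∀ c p t q → c * (p - t * q) ≡ c * p - t * (c * q)
      lemma = solve-∀ ℚ-ring

    scale-back : ∀ c q x → c * q ≡ 1ℚ → q * (c * x) ≡ x
    scale-back c q x inv = trans (lemma c q x) (trans (cong (_* x) inv) (ℚP.*-identityˡ x))
      where
      lemma : ∀ c q x → q * (c * x) ≡ (c * q) * x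
      lemma = solve-∀ ℚ-ring

    neg-sub : ∀ c x p t → c * x ≡ p - t → - c * x ≡ t - p
    neg-sub c x p t eq = trans (sym (ℚP.neg-distribˡ-* c x)) (trans (cong -_ eq) (lemma p t))
      where
      lemma : ∀ p t → - (p - t) ≡ t - p
      lemma = solve-∀ ℚ-ring

    neg-scale : ∀ q c x → - q * (- c * x) ≡ q * (c * x)
    neg-scale = solve-∀ ℚ-ring

    free-dot : ∀ {D} (ℓ v y : Vector D) t → dot ℓ v ≡ 0ℚ → dot ℓ (y −[ t ] v) ≡ dot ℓ y
    free-dot ℓ v y t ℓv≡0 = trans (dot-sub ℓ y t v) (trans (cong (λ z → dot ℓ y - t * z) ℓv≡0) (lemma (dot ℓ y) t))
      where
      lemma : ∀ p t → p - t * 0ℚ ≡ p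
      lemma = solve-∀ ℚ-ring

  -- The functionals in L and U have been rescaled to take the value 1 on v, so a constraint on y -
  -- t v becomes a comparison of t with their value at y.
  BoundedBy : ∀ {D} (L U Z : List (Vector D)) → Vector D → ℚ → Set
  BoundedBy L U Z y t = All (λ l → Pos (t - dot l y)) L × All (λ u → Pos (dot u y - t)) U × All (λ z → Pos (dot z y)) Z

  bounded⁺ : ∀ {D} {v : Vector D} {S L U Z} → Bounds v S L U Z → ∀ y t →
    All (λ ℓ → Pos (dot ℓ (y −[ t ] v))) S → BoundedBy L U Z y t
  bounded⁺ [] y t [] = [] , [] , []
  bounded⁺ {v = v} (above {ℓ = ℓ} {c} _ c>0 inv B) y t (p ∷ ps) =
    let (ls , us , zs) = bounded⁺ B y t ps
    in ls , subst Pos (upper ℓ v y c t inv) (pos-* c>0 p) ∷ us , zs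
  bounded⁺ {v = v} (below {ℓ = ℓ} {c} _ c<0 inv B) y t (p ∷ ps) =
    let (ls , us , zs) = bounded⁺ B y t ps
    in subst Pos (neg-sub c (dot ℓ (y −[ t ] v)) _ t (upper ℓ v y c t inv)) (pos-* c<0 p) ∷ ls , us , zs
  bounded⁺ {v = v} (free {ℓ = ℓ} ℓv≡0 B) y t (p ∷ ps) =
    let (ls , us , zs) = bounded⁺ B y t ps
    in ls , us , subst Pos (free-dot ℓ v y t ℓv≡0) p ∷ zs

  bounded⁻ : ∀ {D} {v : Vector D} {S L U Z} → Bounds v S L U Z → ∀ y t →
    BoundedBy L U Z y t → All (λ ℓ → Pos (dot ℓ (y −[ t ] v))) S
  bounded⁻ [] y t _ = []
  bounded⁻ {v = v} (above {ℓ = ℓ} {c} ℓv>0 _ inv B) y t (ls , u ∷ us , zs) =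
    subst Pos (trans (cong (dot ℓ v *_) (sym (upper ℓ v y c t inv))) (scale-back c (dot ℓ v) _ inv)) (pos-* ℓv>0 u)
    ∷ bounded⁻ B y t (ls , us , zs)
  bounded⁻ {v = v} (below {ℓ = ℓ} {c} ℓv<0 _ inv B) y t (l ∷ ls , us , zs) =
    subst Pos (trans (cong (- dot ℓ v *_) (sym (neg-sub c (dot ℓ (y −[ t ] v)) _ t (upper ℓ v y c t inv))))
      (trans (neg-scale (dot ℓ v) c _) (scale-back c (dot ℓ v) _ inv))) (pos-* ℓv<0 l)
    ∷ bounded⁻ B y t (ls , us , zs)
  bounded⁻ {v = v} (free {ℓ = ℓ} ℓv≡0 B) y t (ls , us , z ∷ zs) =
    subst Pos (sym (free-dot ℓ v y t ℓv≡0)) z ∷ bounded⁻ B y t (ls , us , zs)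

-- The lower bound t ∈ Pos is the zero functional.
fourierMotzkin : ∀ {D} → (L U Z : List (Vector D)) → List (Vector D)
fourierMotzkin L U Z = Z ++ cartesianProductWith (λ u l → u −[ 1ℚ ] l) U ((λ _ → 0ℚ) ∷ L)

module _ (P : Positivity) where
  open Positivity P

  private
    dot-diff : ∀ {D} (u l y : Vector D) → dot (u −[ 1ℚ ] l) y ≡ dot u y - dot l y
    dot-diff u l y = trans (dot-subˡ u l 1ℚ y) (cong (λ z → dot u y - z) (ℚP.*-identityˡ (dot l y)))

    q-0 : ∀ q → q ≡ q - 0ℚ
    q-0 = solve-∀ ℚ-ring

    lower : ∀ {D} {L : List (Vector D)} {y t} → Pos t → All (λ l → Pos (t - dot l y)) L →
      All (λ l → Pos (t - dot l y)) ((λ _ → 0ℚ) ∷ L)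
    lower {y = y} {t} t>0 ls = subst Pos (trans (q-0 t) (cong (λ z → t - z) (sym (dot-zeroˡ y)))) t>0 ∷ ls

  fourierMotzkin⁺ : ∀ {D} (L U Z : List (Vector D)) y t → Pos t → BoundedBy P L U Z y t →
    All (λ ℓ → Pos (dot ℓ y)) (fourierMotzkin L U Z)
  fourierMotzkin⁺ L U Z y t t>0 (ls , us , zs) = AllP.++⁺ zs (All.tabulate pair)
    where
    pair : ∀ {ℓ} → ℓ ∈ cartesianProductWith (λ u l → u −[ 1ℚ ] l) U ((λ _ → 0ℚ) ∷ L) → Pos (dot ℓ y)
    pair ℓ∈ with ∈-cartesianProductWith⁻ (λ u l → u −[ 1ℚ ] l) U ((λ _ → 0ℚ) ∷ L) ℓ∈
    ... | u , l , u∈U , l∈L , refl = subst Pos (sym (dot-diff u l y))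
      (pos-- (dot l y) t (dot u y) (All.lookup us u∈U) (All.lookup (lower t>0 ls) l∈L))

  fourierMotzkin⁻ : ∀ {D} (L U Z : List (Vector D)) y → All (λ ℓ → Pos (dot ℓ y)) (fourierMotzkin L U Z) →
    ∃[ t ] (Pos t × BoundedBy P L U Z y t)
  fourierMotzkin⁻ {D} L U Z y ps = t ,
    subst Pos (sym (trans (q-0 t) (cong (λ z → t - z) (sym (dot-zeroˡ y))))) (proj₁ (proj₂ mid) _ (here refl)) ,
    All.tabulate (λ l∈L → proj₁ (proj₂ mid) _ (there (∈-map⁺ value l∈L))) ,
    All.tabulate (λ u∈U → proj₂ (proj₂ mid) _ (∈-map⁺ value u∈U)) ,
    AllP.++⁻ˡ Z ps
    where
    value : Vector D → ℚ
    value ℓ = dot ℓ y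
    gap : ∀ p q → p ∈ map value ((λ _ → 0ℚ) ∷ L) → q ∈ map value U → Pos (q - p)
    gap p q p∈ q∈ with ∈-map⁻ value {xs = (λ _ → 0ℚ) ∷ L} p∈ | ∈-map⁻ value q∈
    ... | l , l∈ , refl | u , u∈ , refl = subst Pos (dot-diff u l y)
      (All.lookup (AllP.++⁻ʳ Z ps) (∈-cartesianProductWith⁺ (λ u l → u −[ 1ℚ ] l) u∈ l∈))
    mid = between (value (λ _ → 0ℚ)) (map value L) (map value U) gap
    t : ℚ
    t = proj₁ mid

-- Simultaneous descriptions of a cone and its interior

Describes : ∀ {D k} → Positivity → (Fin k → Vector D) → (E S : List (Vector D)) → Set
Describes P V E S = ∀ y → (Cone P V y → Solution P E S y) × (Solution P E S y → Cone P V y)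

-- E cuts out the linear span of the generators: `vanishing` and `spanning` are the two inclusions.
-- The basis is chosen among the generators, because `Dim` counts affinely independent ones and
-- `rank` will be compared with it.
record Description {D k} (V : Fin k → Vector D) : Set where
  field
    E S         : List (Vector D)
    cone        : Describes nonnegative V E S
    interior    : Describes positive V E S
    vanishing   : ∀ i → All (λ ℓ → dot ℓ (V i) ≡ 0ℚ) E
    rank        : ℕ
    basis       : Fin rank → Fin k
    independent : ∀ (μ : Fin rank → ℚ) → (∀ j → Σℚ (λ i → μ i * V (basis i) j) ≡ 0ℚ) → ∀ i → μ i ≡ 0ℚ
    spanning    : ∀ y → All (λ ℓ → dot ℓ y ≡ 0ℚ) E →
                  Σ (Fin rank → ℚ) λ c → ∀ j → y j ≡ Σℚ (λ i → c i * V (basis i) j)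

  cone? : ∀ y → Dec (Cone nonnegative V y)
  cone? y = map′ (proj₂ (cone y)) (proj₁ (cone y)) (solution? nonnegative E S y)

  interior? : ∀ y → Dec (Cone positive V y)
  interior? y = map′ (proj₂ (interior y)) (proj₁ (interior y)) (solution? positive E S y)

unit : ∀ {D} → Fin D → Vector D
unit zero    zero    = 1ℚ
unit zero    (suc j) = 0ℚ
unit (suc i) zero    = 0ℚ
unit (suc i) (suc j) = unit i j

dot-unit : ∀ {D} (i : Fin D) y → dot (unit i) y ≡ y i
dot-unit zero    y = trans (cong₂ _+_ (ℚP.*-identityˡ (y zero)) (Σℚ-zero (λ j → ℚP.*-zeroˡ (y (suc j))))) (ℚP.+-identityʳ _)
dot-unit (suc i) y = trans (cong₂ _+_ (ℚP.*-zeroˡ (y zero)) (dot-unit i (y ∘ suc))) (ℚP.+-identityˡ _)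

describe-empty : ∀ {D} (V : Fin 0 → Vector D) → Description V
describe-empty {D} V = record
  { E = List.tabulate unit
  ; S = []
  ; cone        = describes nonnegative
  ; interior    = describes positive
  ; vanishing   = λ ()
  ; rank        = 0
  ; basis       = λ ()
  ; independent = λ _ _ ()
  ; spanning    = λ y e → (λ ()) , coordinates y e
  }
  where
  coordinates : ∀ y → All (λ ℓ → dot ℓ y ≡ 0ℚ) (List.tabulate unit) → ∀ j → y j ≡ 0ℚ
  coordinates y e j = trans (sym (dot-unit j y)) (All.lookup e (∈-tabulate⁺ {f = unit} j))
  describes : ∀ P → Describes P V (List.tabulate unit) []
  describes P y = (λ y≡0 → AllP.tabulate⁺ (λ j → trans (dot-unit j y) (y≡0 j)) , [])
                , (λ { (e , []) → coordinates y e })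

-- Adding a generator outside the span of the others: t is determined by one of the equations.

module Transversal {D k} (V : Fin (suc k) → Vector D) (𝓓 : Description (V ∘ suc))
  {ℓ : Vector D} (ℓ∈E : ℓ ∈ Description.E 𝓓) (c : ℚ) (inv : c * dot ℓ (V zero) ≡ 1ℚ) where
  open Description 𝓓

  private
    v : Vector D
    v = V zero

  τ : Vector D
  τ = c ⊙ ℓ

  private
    τv≡1 : dot τ v ≡ 1ℚ
    τv≡1 = trans (dot-⊙ˡ c ℓ v) inv

    -- The pullback of a functional along the projection y ↦ y - τ(y) v: the forced value t = τ(y)
    -- is substituted.
    elim : Vector D → Vector D
    elim a = a −[ dot a v ] τ

    dot-elim : ∀ a y → dot (elim a) y ≡ dot a (y −[ dot τ y ] v)
    dot-elim a y = trans (dot-subˡ a τ (dot a v) y)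
      (trans (cong (λ z → dot a y - z) (ℚP.*-comm (dot a v) (dot τ y))) (sym (dot-sub a y (dot τ y) v)))

    dot-elim-vanishing : ∀ a y → dot a y ≡ 0ℚ → dot τ y ≡ 0ℚ → dot (elim a) y ≡ 0ℚ
    dot-elim-vanishing a y ay≡0 τy≡0 = trans (dot-subˡ a τ (dot a v) y)
      (trans (cong₂ (λ p q → p - dot a v * q) ay≡0 τy≡0) (lemma (dot a v)))
      where
      lemma : ∀ q → 0ℚ - q * 0ℚ ≡ 0ℚ
      lemma = solve-∀ ℚ-ring

  -- τ vanishes wherever E does and equals 1 on v, so it reads off the coefficient of v.
  height : ∀ y t → All (λ a → dot a (y −[ t ] v) ≡ 0ℚ) E → t ≡ dot τ y
  height y t e = begin
    t                                          ≡⟨ lemma t (dot τ y) ⟩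
    dot τ y - (dot τ y - t * 1ℚ)               ≡⟨ cong (λ z → dot τ y - (dot τ y - t * z)) τv≡1 ⟨
    dot τ y - (dot τ y - t * dot τ v)          ≡⟨ cong (λ z → dot τ y - z) (dot-sub τ y t v) ⟨
    dot τ y - dot τ (y −[ t ] v)               ≡⟨ cong (λ z → dot τ y - z) (dot-⊙ˡ c ℓ (y −[ t ] v)) ⟩
    dot τ y - c * dot ℓ (y −[ t ] v)           ≡⟨ cong (λ z → dot τ y - c * z) (All.lookup e ℓ∈E) ⟩
    dot τ y - c * 0ℚ                           ≡⟨ lemma′ (dot τ y) c ⟩
    dot τ y                                    ∎
    where
    lemma : ∀ t q → t ≡ q - (q - t * 1ℚ)
    lemma = solve-∀ ℚ-ring
    lemma′ : ∀ q c → q - c * 0ℚ ≡ q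
    lemma′ = solve-∀ ℚ-ring

  private
    elim⁺ : ∀ (Q : ℚ → Set) y A → All (λ a → Q (dot a (y −[ dot τ y ] v))) A → All (λ a → Q (dot a y)) (map elim A)
    elim⁺ Q y []      []       = []
    elim⁺ Q y (a ∷ A) (q ∷ qs) = subst Q (sym (dot-elim a y)) q ∷ elim⁺ Q y A qs

    elim⁻ : ∀ (Q : ℚ → Set) y A → All (λ a → Q (dot a y)) (map elim A) → All (λ a → Q (dot a (y −[ dot τ y ] v))) A
    elim⁻ Q y []      []       = []
    elim⁻ Q y (a ∷ A) (q ∷ qs) = subst Q (dot-elim a y) q ∷ elim⁻ Q y A qs

    describes : ∀ P → Describes P (V ∘ suc) E S → Describes P V (map elim E) (τ ∷ map elim S)
    describes P inner y = to , from
      where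
      open Positivity P
      to : Cone P V y → Solution P (map elim E) (τ ∷ map elim S) y
      to (t , t>0 , cn) = elim⁺ (_≡ 0ℚ) y E (proj₁ es) , subst Pos t≡τy t>0 ∷ elim⁺ Pos y S (proj₂ es)
        where
        t≡τy : t ≡ dot τ y
        t≡τy = height y t (proj₁ (proj₁ (inner (y −[ t ] v)) cn))
        es : Solution P E S (y −[ dot τ y ] v)
        es = subst (λ u → Solution P E S (y −[ u ] v)) t≡τy (proj₁ (inner (y −[ t ] v)) cn)
      from : Solution P (map elim E) (τ ∷ map elim S) y → Cone P V y
      from (e , t>0 ∷ s) = dot τ y , t>0 , proj₂ (inner (y −[ dot τ y ] v)) (elim⁻ (_≡ 0ℚ) y E e , elim⁻ Pos y S s)

    basis′ : Fin (suc rank) → Fin (suc k)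
    basis′ zero    = zero
    basis′ (suc i) = suc (basis i)

    τ-vanishing : ∀ i → dot τ (V (suc i)) ≡ 0ℚ
    τ-vanishing i = trans (dot-⊙ˡ c ℓ (V (suc i)))
      (trans (cong (c *_) (All.lookup (vanishing i) ℓ∈E)) (ℚP.*-zeroʳ c))

    dot-combination : ∀ {n} (a : Vector D) (μ : Fin n → ℚ) (W : Fin n → Vector D) →
      dot a (λ j → Σℚ (λ i → μ i * W i j)) ≡ Σℚ (λ i → μ i * dot a (W i))
    dot-combination a μ W = begin
      Σℚ (λ j → a j * Σℚ (λ i → μ i * W i j))      ≡⟨ Σℚ-cong (λ j → Σℚ-*ˡ (a j) (λ i → μ i * W i j)) ⟨
      Σℚ (λ j → Σℚ (λ i → a j * (μ i * W i j)))    ≡⟨ Σℚ-swap (λ j i → a j * (μ i * W i j)) ⟩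
      Σℚ (λ i → Σℚ (λ j → a j * (μ i * W i j)))    ≡⟨ Σℚ-cong (λ i → Σℚ-cong (λ j → lemma (a j) (μ i) (W i j))) ⟩
      Σℚ (λ i → Σℚ (λ j → μ i * (a j * W i j)))    ≡⟨ Σℚ-cong (λ i → Σℚ-*ˡ (μ i) (λ j → a j * W i j)) ⟩
      Σℚ (λ i → μ i * dot a (W i))                 ∎
      where
      lemma : ∀ a m w → a * (m * w) ≡ m * (a * w)
      lemma = solve-∀ ℚ-ring

    -- Applying τ to a relation isolates the coefficient of v, and what remains is a relation among
    -- the old basis.
    independent′ : ∀ (μ : Fin (suc rank) → ℚ) → (∀ j → Σℚ (λ i → μ i * V (basis′ i) j) ≡ 0ℚ) → ∀ i → μ i ≡ 0ℚ
    independent′ μ rel = λ { zero → μ₀≡0 ; (suc i) → independent (μ ∘ suc) rel′ i }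
      where
      W : Fin (suc rank) → Vector D
      W i = V (basis′ i)
      μ₀≡0 : μ zero ≡ 0ℚ
      μ₀≡0 = begin
        μ zero                            ≡⟨ ℚP.*-identityʳ (μ zero) ⟨
        μ zero * 1ℚ                       ≡⟨ cong (μ zero *_) τv≡1 ⟨
        μ zero * dot τ v                  ≡⟨ ℚP.+-identityʳ _ ⟨
        μ zero * dot τ v + 0ℚ             ≡⟨ cong (μ zero * dot τ v +_) (Σℚ-zero (λ i →
          trans (cong (μ (suc i) *_) (τ-vanishing (basis i))) (ℚP.*-zeroʳ (μ (suc i))))) ⟨
        Σℚ (λ i → μ i * dot τ (W i))      ≡⟨ dot-combination τ μ W ⟨
        dot τ (λ j → Σℚ (λ i → μ i * W i j)) ≡⟨ Σℚ-zero (λ j → trans (cong (τ j *_) (rel j)) (ℚP.*-zeroʳ (τ j))) ⟩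
        0ℚ                                ∎
      rel′ : ∀ j → Σℚ (λ i → μ (suc i) * V (suc (basis i)) j) ≡ 0ℚ
      rel′ j = trans (sym (ℚP.+-identityˡ _)) (trans
        (cong (_+ Σℚ (λ i → μ (suc i) * V (suc (basis i)) j)) (sym (trans (cong (_* v j) μ₀≡0) (ℚP.*-zeroˡ (v j)))))
        (rel j))

    spanning′ : ∀ y → All (λ a → dot a y ≡ 0ℚ) (map elim E) →
      Σ (Fin (suc rank) → ℚ) λ μ → ∀ j → y j ≡ Σℚ (λ i → μ i * V (basis′ i) j)
    spanning′ y e with spanning (y −[ dot τ y ] v) (elim⁻ (_≡ 0ℚ) y E e)
    ... | μ , eq = μ′ , λ j → trans (lemma (y j) (dot τ y * v j)) (cong (dot τ y * v j +_) (eq j))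
      where
      μ′ : Fin (suc rank) → ℚ
      μ′ zero    = dot τ y
      μ′ (suc i) = μ i
      lemma : ∀ p q → p ≡ q + (p - q)
      lemma = solve-∀ ℚ-ring

    vanishing′ : ∀ i → All (λ a → dot a (V i) ≡ 0ℚ) (map elim E)
    vanishing′ zero    = AllP.map⁺ (All.universal (λ a → trans (dot-subˡ a τ (dot a v) v)
      (trans (cong (λ z → dot a v - dot a v * z) τv≡1) (lemma (dot a v)))) E)
      where
      lemma : ∀ q → q - q * 1ℚ ≡ 0ℚ
      lemma = solve-∀ ℚ-ring
    vanishing′ (suc i) = AllP.map⁺ (All.map (λ {a} p → dot-elim-vanishing a (V (suc i)) p (τ-vanishing i)) (vanishing i))

  describe : Description V
  describe = record
    { E           = map elim E
    ; S           = τ ∷ map elim S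
    ; cone        = describes nonnegative cone
    ; interior    = describes positive interior
    ; vanishing   = vanishing′
    ; rank        = suc rank
    ; basis       = basis′
    ; independent = independent′
    ; spanning    = spanning′
    }

-- Adding a generator in the span of the others: t is eliminated by Fourier–Motzkin.

module Spanned {D k} (V : Fin (suc k) → Vector D) (𝓓 : Description (V ∘ suc))
  (Ev≡0 : All (λ a → dot a (V zero) ≡ 0ℚ) (Description.E 𝓓)) where
  open Description 𝓓

  private
    v : Vector D
    v = V zero
    L U Z : List (Vector D)
    L = proj₁ (bounds v S)
    U = proj₁ (proj₂ (bounds v S))
    Z = proj₁ (proj₂ (proj₂ (bounds v S)))
    B : Bounds v S L U Z
    B = proj₂ (proj₂ (proj₂ (bounds v S)))

    along : ∀ y t → ∀ a → dot a v ≡ 0ℚ → dot a (y −[ t ] v) ≡ dot a y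
    along y t a av≡0 = trans (dot-sub a y t v) (trans (cong (λ z → dot a y - t * z) av≡0) (lemma (dot a y) t))
      where
      lemma : ∀ p t → p - t * 0ℚ ≡ p
      lemma = solve-∀ ℚ-ring

    equations⁺ : ∀ y t → All (λ a → dot a (y −[ t ] v) ≡ 0ℚ) E → All (λ a → dot a y ≡ 0ℚ) E
    equations⁺ y t e = All.zipWith (λ {a} (p , q) → trans (sym (along y t a p)) q) (Ev≡0 , e)

    equations⁻ : ∀ y t → All (λ a → dot a y ≡ 0ℚ) E → All (λ a → dot a (y −[ t ] v) ≡ 0ℚ) E
    equations⁻ y t e = All.zipWith (λ {a} (p , q) → trans (along y t a p) q) (Ev≡0 , e)

    describes : ∀ P → Describes P (V ∘ suc) E S → Describes P V E (fourierMotzkin L U Z)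
    describes P inner y = to , from
      where
      open Positivity P
      to : Cone P V y → Solution P E (fourierMotzkin L U Z) y
      to (t , t>0 , cn) with proj₁ (inner (y −[ t ] v)) cn
      ... | e , s = equations⁺ y t e , fourierMotzkin⁺ P L U Z y t t>0 (bounded⁺ P B y t s)
      from : Solution P E (fourierMotzkin L U Z) y → Cone P V y
      from (e , s) with fourierMotzkin⁻ P L U Z y s
      ... | t , t>0 , b = t , t>0 , proj₂ (inner (y −[ t ] v)) (equations⁻ y t e , bounded⁻ P B y t b)

  describe : Description V
  describe = record
    { E           = E
    ; S           = fourierMotzkin L U Z
    ; cone        = describes nonnegative cone
    ; interior    = describes positive interior
    ; vanishing   = λ { zero → Ev≡0 ; (suc i) → vanishing i }
    ; rank        = rank
    ; basis       = suc ∘ basis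
    ; independent = independent
    ; spanning    = spanning
    }

  -- The fibre over y is the interval from the greatest lower bound to the least upper bound on t.
  -- The a priori bound `hi` keeps the right end finite when U is empty, and the given point t₀
  -- certifies the constraints that do not involve t.
  slice : ∀ P → Describes P (V ∘ suc) E S → let open Positivity P in
    ∀ y hi t₀ → (∀ t → Cone P (V ∘ suc) (y −[ t ] v) → Pos (hi - t)) →
    Pos t₀ → Cone P (V ∘ suc) (y −[ t₀ ] v) →
    ∃[ a ] ∃[ b ] ((∀ t → Pos t → Cone P (V ∘ suc) (y −[ t ] v) → Pos (t - a) × Pos (b - t)) ×
                   (∀ t → Pos (t - a) → Pos (b - t) → Pos t × Cone P (V ∘ suc) (y −[ t ] v)))
  slice P inner y hi t₀ bounded t₀>0 cn₀ = a , b , to , from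
    where
    open Positivity P
    value : Vector D → ℚ
    value ℓ = dot ℓ y
    a b : ℚ
    a = proj₁ (maximum 0ℚ (map value L))
    b = proj₁ (minimum hi (map value U))
    q-0 : ∀ q → q ≡ q - 0ℚ
    q-0 = solve-∀ ℚ-ring
    to : ∀ t → Pos t → Cone P (V ∘ suc) (y −[ t ] v) → Pos (t - a) × Pos (b - t)
    to t t>0 cn with bounded⁺ P B y t (proj₂ (proj₁ (inner (y −[ t ] v)) cn))
    ... | ls , us , _ =
      All.lookup {P = λ x → Pos (t - x)} (subst Pos (q-0 t) t>0 ∷ AllP.map⁺ ls) (proj₁ (proj₂ (maximum 0ℚ (map value L)))) ,
      All.lookup {P = λ x → Pos (x - t)} (bounded t cn ∷ AllP.map⁺ us) (proj₁ (proj₂ (minimum hi (map value U))))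
    from : ∀ t → Pos (t - a) → Pos (b - t) → Pos t × Cone P (V ∘ suc) (y −[ t ] v)
    from t t>a t<b with proj₁ (inner (y −[ t₀ ] v)) cn₀ | proj₂ (proj₂ (maximum 0ℚ (map value L))) | proj₂ (proj₂ (minimum hi (map value U)))
    ... | e , s | 0≤a ∷ ub | _ ∷ lb =
      subst Pos (sym (q-0 t)) (≤-pos-- 0ℚ a t 0≤a t>a) ,
      proj₂ (inner (y −[ t ] v)) (equations⁻ y t (equations⁺ y t₀ e) , bounded⁻ P B y t
        ( All.map (λ {l} l≤a → ≤-pos-- (dot l y) a t l≤a t>a) (AllP.map⁻ ub)
        , All.map (λ {u} b≤u → pos--≤ t b (dot u y) b≤u t<b) (AllP.map⁻ lb)
        , proj₂ (proj₂ (bounded⁺ P B y t₀ s)) ))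

-- Iterated differences under the Euler integral

euler-- : ∀ {f g a b} → EulerIntegral f a → EulerIntegral g b → EulerIntegral (λ t → f t - g t) (a - b)
euler-- {f} {g} {a} {b} p q = subst (EulerIntegral _) (cong (a +_) (lemma b))
  (euler-cong (λ t → cong (f t +_) (lemma (g t))) (euler-+ p (euler-* (- 1ℚ) q)))
  where
  lemma : ∀ b → - 1ℚ * b ≡ - b
  lemma = solve-∀ ℚ-ring

∇ : ∀ {D k} → (Fin k → Vector D) → (Vector D → ℚ) → Vector D → ℚ
∇ {k = zero}  V g = g
∇ {k = suc k} V g = ∇ (V ∘ suc) (λ y → g y - g (y −[ 1ℚ ] V zero))

-- Vectors are functions compared pointwise, so invariance under that equality has to be carried
-- along.
Extensional : ∀ {D} → (Vector D → ℚ) → Set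
Extensional g = ∀ {y z} → y ≗ z → g y ≡ g z

∇-cong : ∀ {D k} (V : Fin k → Vector D) {g h} → (∀ y → g y ≡ h y) → ∀ y → ∇ V g y ≡ ∇ V h y
∇-cong {k = zero}  V eq y = eq y
∇-cong {k = suc k} V eq y = ∇-cong (V ∘ suc) (λ z → cong₂ _-_ (eq z) (eq (z −[ 1ℚ ] V zero))) y

∇-translate : ∀ {D k} (V : Fin k → Vector D) {g} → Extensional g → ∀ c t w y →
  ∇ V (λ z → c * g (z −[ t ] w)) y ≡ c * ∇ V g (y −[ t ] w)
∇-translate {k = zero}  V ext c t w y = refl
∇-translate {k = suc k} V {g} ext c t w y = trans
  (∇-cong (V ∘ suc) (λ z → trans
    (cong (λ q → c * g (z −[ t ] w) - c * q) (ext (λ j → commute (z j) (V zero j) t (w j))))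
    (factor c _ _)) y)
  (∇-translate (V ∘ suc) (λ y≗z → cong₂ _-_ (ext y≗z) (ext (λ j → cong (_- 1ℚ * V zero j) (y≗z j)))) c t w y)
  where
  commute : ∀ z v t w → (z - 1ℚ * v) - t * w ≡ (z - t * w) - 1ℚ * v
  commute = solve-∀ ℚ-ring
  factor : ∀ c p q → c * p - c * q ≡ c * (p - q)
  factor = solve-∀ ℚ-ring

∇-euler : ∀ {D k} (V : Fin k → Vector D) {f : Vector D → ℚ → ℚ} {F : Vector D → ℚ} →
  (∀ y → EulerIntegral (f y) (F y)) → ∀ y → EulerIntegral (λ t → ∇ V (λ z → f z t) y) (∇ V F y)
∇-euler {k = zero}  V eu y = eu y
∇-euler {k = suc k} V eu y = ∇-euler (V ∘ suc) (λ z → euler-- (eu z) (eu (z −[ 1ℚ ] V zero))) y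

module _ {D k} {V : Fin k → Vector D} (𝓓 : Description V) where
  open Description 𝓓

  ε : ℚ
  ε = (- 1ℚ) ^ℚ rank

  [cone] [-interior] reciprocal : Vector D → ℚ
  [cone]      y = ind (cone? y)
  [-interior] y = ε * ind (interior? (neg y))
  reciprocal  y = [cone] y - [-interior] y

  [cone]-ext : Extensional [cone]
  [cone]-ext y≗z = ind-cong (cone? _) (cone? _) (Cone-resp nonnegative V y≗z) (Cone-resp nonnegative V (sym ∘ y≗z))

  [-interior]-ext : Extensional [-interior]
  [-interior]-ext y≗z = cong (ε *_) (ind-cong (interior? _) (interior? _)
    (Cone-resp positive V (cong -_ ∘ y≗z)) (Cone-resp positive V (cong -_ ∘ sym ∘ y≗z)))

  reciprocal-ext : Extensional reciprocal
  reciprocal-ext y≗z = cong₂ _-_ ([cone]-ext y≗z) ([-interior]-ext y≗z)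

[≥0] : ℚ → ℚ
[≥0] t = ind (0ℚ ℚP.≤? t)

-- Both cones over v ∷ V are obtained from those over V by Euler integration along v.
record Fibred {D k} (V : Fin (suc k) → Vector D) (𝓓′ : Description (V ∘ suc)) (𝓓 : Description V) : Set where
  field
    closed : ∀ y → EulerIntegral (λ t → [≥0] t * [cone] 𝓓′ (y −[ t ] V zero)) ([cone] 𝓓 y)
    open′  : ∀ y → EulerIntegral (λ t → ([≥0] t - 1ℚ) * [-interior] 𝓓′ (y −[ t ] V zero)) ([-interior] 𝓓 y)

∇-reciprocal-step : ∀ {D k} (V : Fin (suc k) → Vector D) {𝓓′ : Description (V ∘ suc)} {𝓓 : Description V} →
  Fibred V 𝓓′ 𝓓 → (∀ y → ∇ (V ∘ suc) (reciprocal 𝓓′) y ≡ 0ℚ) → ∀ y → ∇ V (reciprocal 𝓓) y ≡ 0ℚ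
∇-reciprocal-step {D} V {𝓓′} {𝓓} fib ih y = euler-zero vanish (∇-euler (V ∘ suc) difference y)
  where
  open Fibred fib
  v : Vector D
  v = V zero
  fibre : Vector D → ℚ → ℚ
  fibre y t = [≥0] t * [cone] 𝓓′ (y −[ t ] v) - ([≥0] t - 1ℚ) * [-interior] 𝓓′ (y −[ t ] v)
  window : ℚ → ℚ
  window t = [≥0] t - [≥0] (t - 1ℚ)
  fibre-euler : ∀ y → EulerIntegral (fibre y) (reciprocal 𝓓 y)
  fibre-euler y = euler-- (closed y) (open′ y)
  shifted : ∀ y t → (y −[ 1ℚ ] v) −[ t - 1ℚ ] v ≗ y −[ t ] v
  shifted y t j = lemma (y j) (v j) t
    where
    lemma : ∀ y v t → (y - 1ℚ * v) - (t - 1ℚ) * v ≡ y - t * v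
    lemma = solve-∀ ℚ-ring
  -- Moving the second fibre by 1 brings both to the same point y - t v. The constant -1 in the
  -- weight of the interior term then cancels, which leaves the common factor `window`, the
  -- indicator of 0 ≤ t < 1.
  windowed : ∀ y t → fibre y t - fibre (y −[ 1ℚ ] v) (t - 1ℚ) ≡ window t * reciprocal 𝓓′ (y −[ t ] v)
  windowed y t = trans
    (cong₂ (λ p q → fibre y t - ([≥0] (t - 1ℚ) * p - ([≥0] (t - 1ℚ) - 1ℚ) * q))
      ([cone]-ext 𝓓′ (shifted y t)) ([-interior]-ext 𝓓′ (shifted y t)))
    (lemma ([≥0] t) ([≥0] (t - 1ℚ)) _ _)
    where
    lemma : ∀ h h′ c o → (h * c - (h - 1ℚ) * o) - (h′ * c - (h′ - 1ℚ) * o) ≡ (h - h′) * (c - o)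
    lemma = solve-∀ ℚ-ring
  difference : ∀ y → EulerIntegral (λ t → window t * reciprocal 𝓓′ (y −[ t ] v))
    (reciprocal 𝓓 y - reciprocal 𝓓 (y −[ 1ℚ ] v))
  difference y = euler-cong (windowed y)
    (euler-- (fibre-euler y) (euler-shift 1ℚ (fibre-euler (y −[ 1ℚ ] v))))
  vanish : ∀ t → ∇ (V ∘ suc) (λ z → window t * reciprocal 𝓓′ (z −[ t ] v)) y ≡ 0ℚ
  vanish t = trans (∇-translate (V ∘ suc) (reciprocal-ext 𝓓′) (window t) t v y)
    (trans (cong (window t *_) (ih (y −[ t ] v))) (ℚP.*-zeroʳ (window t)))

-- Euler characteristics of the fibres along a new generator

module _ {D k} (V : Fin (suc k) → Vector D) (𝓓′ : Description (V ∘ suc)) where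
  private
    module 𝓓′ = Description 𝓓′
    v : Vector D
    v = V zero

  closed-fibre : ∀ y → Cone nonnegative V y → ∀ a b →
    (∀ t → 0ℚ ≤ t → Cone nonnegative (V ∘ suc) (y −[ t ] v) → a ≤ t × t ≤ b) →
    (∀ t → a ≤ t → t ≤ b → 0ℚ ≤ t × Cone nonnegative (V ∘ suc) (y −[ t ] v)) →
    EulerIntegral (λ t → [≥0] t * [cone] 𝓓′ (y −[ t ] v)) 1ℚ
  closed-fibre y (t₀ , t₀≥0 , c₀) a b to from =
    euler-cong (λ t → sym (ind-× (0ℚ ℚP.≤? t) (𝓓′.cone? (y −[ t ] v))))
      (euler-closed (λ t → (0ℚ ℚP.≤? t) ×-dec 𝓓′.cone? (y −[ t ] v))
        (ℚP.≤-trans (proj₁ (to t₀ t₀≥0 c₀)) (proj₂ (to t₀ t₀≥0 c₀)))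
        (λ { t (t≥0 , c) → to t t≥0 c }) from)

  closed-empty : ∀ y → ¬ Cone nonnegative V y → EulerIntegral (λ t → [≥0] t * [cone] 𝓓′ (y −[ t ] v)) 0ℚ
  closed-empty y ¬c = euler-empty (λ t → trans (ind-× (0ℚ ℚP.≤? t) (𝓓′.cone? (y −[ t ] v)))
    (ind-no ((0ℚ ℚP.≤? t) ×-dec 𝓓′.cone? (y −[ t ] v)) (λ { (t≥0 , c) → ¬c (t , t≥0 , c) })))

  private
    -- For t < 0, -(y - t v) is -y - (-t) v, so such a t is a positive coefficient -t of v in a
    -- representation of -y.
    Backward : Vector D → ℚ → Set
    Backward y t = 0ℚ < - t × Cone positive (V ∘ suc) (neg y −[ - t ] v)

    backward? : ∀ y t → Dec (Backward y t)
    backward? y t = (0ℚ ℚP.<? - t) ×-dec 𝓓′.interior? (neg y −[ - t ] v)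

    neg-sub : ∀ y t → neg (y −[ t ] v) ≗ neg y −[ - t ] v
    neg-sub y t j = lemma (y j) t (v j)
      where
      lemma : ∀ y t v → - (y - t * v) ≡ - y - - t * v
      lemma = solve-∀ ℚ-ring

    negneg : ∀ t → - - t ≡ t
    negneg = solve-∀ ℚ-ring

    [<0] : ∀ t → [≥0] t - 1ℚ ≡ - ind (0ℚ ℚP.<? - t)
    [<0] t with 0ℚ ℚP.≤? t | 0ℚ ℚP.<? - t
    ... | yes _   | no _    = refl
    ... | no _    | yes _   = refl
    ... | yes t≥0 | yes t<0 = contradiction (ℚP.<-≤-trans (subst (_< 0ℚ) (negneg t) (ℚP.neg-antimono-< t<0)) t≥0) (ℚP.<-irrefl refl)
    ... | no t≱0  | no t≮0  = contradiction (ℚP.neg-antimono-< (ℚP.≰⇒> t≱0)) t≮0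

    backward-indicator : ∀ y t → ([≥0] t - 1ℚ) * [-interior] 𝓓′ (y −[ t ] v) ≡ - ε 𝓓′ * ind (backward? y t)
    backward-indicator y t = begin
      ([≥0] t - 1ℚ) * (ε 𝓓′ * ind (𝓓′.interior? (neg (y −[ t ] v))))
        ≡⟨ cong₂ (λ p q → p * (ε 𝓓′ * q)) ([<0] t) (ind-cong (𝓓′.interior? _) (𝓓′.interior? _)
             (Cone-resp positive (V ∘ suc) (neg-sub y t)) (Cone-resp positive (V ∘ suc) (sym ∘ neg-sub y t))) ⟩
      - ind (0ℚ ℚP.<? - t) * (ε 𝓓′ * ind (𝓓′.interior? (neg y −[ - t ] v)))
        ≡⟨ lemma (ind (0ℚ ℚP.<? - t)) (ε 𝓓′) _ ⟩
      - ε 𝓓′ * (ind (0ℚ ℚP.<? - t) * ind (𝓓′.interior? (neg y −[ - t ] v)))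
        ≡⟨ cong (- ε 𝓓′ *_) (ind-× (0ℚ ℚP.<? - t) (𝓓′.interior? (neg y −[ - t ] v))) ⟩
      - ε 𝓓′ * ind (backward? y t) ∎
      where
      lemma : ∀ h e i → - h * (e * i) ≡ - e * (h * i)
      lemma = solve-∀ ℚ-ring

  open-empty : ∀ y → ¬ Cone positive V (neg y) →
    EulerIntegral (λ t → ([≥0] t - 1ℚ) * [-interior] 𝓓′ (y −[ t ] v)) 0ℚ
  open-empty y ¬c = euler-empty (λ t → trans (backward-indicator y t)
    (trans (cong (- ε 𝓓′ *_) (ind-no (backward? y t) (λ { (-t>0 , c) → ¬c (- t , -t>0 , c) })))
      (ℚP.*-zeroʳ (- ε 𝓓′))))

  -- The transversal case: a point counts 1, so the minus sign of the weight remains and accounts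
  -- for the rank going up by one.
  open-point : ∀ y u → 0ℚ < u → Cone positive (V ∘ suc) (neg y −[ u ] v) →
    (∀ t → Cone positive (V ∘ suc) (neg y −[ t ] v) → t ≡ u) →
    EulerIntegral (λ t → ([≥0] t - 1ℚ) * [-interior] 𝓓′ (y −[ t ] v)) (- ε 𝓓′ * 1ℚ)
  open-point y u u>0 c unique = euler-cong (λ t → sym (backward-indicator y t)) (euler-* (- ε 𝓓′)
    (euler-closed {a = - u} {b = - u} (backward? y) ℚP.≤-refl
      (λ { t (_ , ct) → let t≡-u = trans (sym (negneg t)) (cong -_ (unique (- t) ct)) in
           ℚP.≤-reflexive (sym t≡-u) , ℚP.≤-reflexive t≡-u })
      (λ t t≥-u t≤-u → let -t≡u = trans (cong -_ (ℚP.≤-antisym t≤-u t≥-u)) (negneg u) in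
           subst (0ℚ <_) (sym -t≡u) u>0 ,
           subst (λ q → Cone positive (V ∘ suc) (neg y −[ q ] v)) (sym -t≡u) c)))

  -- The spanned case: an open interval counts -1, which cancels the minus sign of the weight, in
  -- accordance with the unchanged rank.
  open-interval : ∀ y a b → a < b →
    (∀ t → 0ℚ < t → Cone positive (V ∘ suc) (neg y −[ t ] v) → a < t × t < b) →
    (∀ t → a < t → t < b → 0ℚ < t × Cone positive (V ∘ suc) (neg y −[ t ] v)) →
    EulerIntegral (λ t → ([≥0] t - 1ℚ) * [-interior] 𝓓′ (y −[ t ] v)) (- ε 𝓓′ * - 1ℚ)
  open-interval y a b a<b to from = euler-cong (λ t → sym (backward-indicator y t)) (euler-* (- ε 𝓓′)
    (euler-open {a = - b} {b = - a} (backward? y) (ℚP.neg-antimono-< a<b)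
      (λ { t (-t>0 , c) → let (a<-t , -t<b) = to (- t) -t>0 c in
           subst (- b <_) (negneg t) (ℚP.neg-antimono-< -t<b) ,
           subst (_< - a) (negneg t) (ℚP.neg-antimono-< a<-t) })
      (λ t -b<t t<-a → from (- t) (subst (_< - t) (negneg a) (ℚP.neg-antimono-< t<-a))
           (subst (- t <_) (negneg b) (ℚP.neg-antimono-< -b<t)))))

transversal-fibred : ∀ {D k} (V : Fin (suc k) → Vector D) (𝓓 : Description (V ∘ suc)) {ℓ} (ℓ∈E : ℓ ∈ Description.E 𝓓)
  c (inv : c * dot ℓ (V zero) ≡ 1ℚ) → Fibred V 𝓓 (Transversal.describe V 𝓓 ℓ∈E c inv)
transversal-fibred {D} V 𝓓′ ℓ∈E c inv = record { closed = closed ; open′ = open′ }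
  where
  open Transversal V 𝓓′ ℓ∈E c inv
  open Description
  v : Vector D
  v = V zero
  closed : ∀ y → EulerIntegral (λ t → [≥0] t * [cone] 𝓓′ (y −[ t ] v)) ([cone] describe y)
  closed y with cone? describe y
  ... | no ¬c = closed-empty V 𝓓′ y ¬c
  ... | yes (u , u≥0 , cu) = closed-fibre V 𝓓′ y (u , u≥0 , cu) u u
      (λ t _ c → ℚP.≤-reflexive (sym (unique t c)) , ℚP.≤-reflexive (unique t c))
      (λ t u≤t t≤u → subst (λ q → 0ℚ ≤ q × Cone nonnegative (V ∘ suc) (y −[ q ] v)) (ℚP.≤-antisym u≤t t≤u) (u≥0 , cu))
    where
    unique : ∀ t → Cone nonnegative (V ∘ suc) (y −[ t ] v) → t ≡ u
    unique t c = trans (height y t (proj₁ (proj₁ (cone 𝓓′ _) c))) (sym (height y u (proj₁ (proj₁ (cone 𝓓′ _) cu))))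
  sign : ∀ e → - e * 1ℚ ≡ (- 1ℚ * e) * 1ℚ
  sign = solve-∀ ℚ-ring
  open′ : ∀ y → EulerIntegral (λ t → ([≥0] t - 1ℚ) * [-interior] 𝓓′ (y −[ t ] v)) ([-interior] describe y)
  open′ y with interior? describe (neg y)
  ... | no ¬c = subst (EulerIntegral _) (sym (ℚP.*-zeroʳ (ε describe))) (open-empty V 𝓓′ y ¬c)
  ... | yes (u , u>0 , cu) = subst (EulerIntegral _) (sign (ε 𝓓′)) (open-point V 𝓓′ y u u>0 cu
      (λ t c → trans (height (neg y) t (proj₁ (proj₁ (interior 𝓓′ _) c)))
        (sym (height (neg y) u (proj₁ (proj₁ (interior 𝓓′ _) cu))))))

-- Hence the slices of a cone along one of its generators are bounded, and have an Euler integral.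
cone-height : ∀ P {d k} (V : Fin k → Vector (suc d)) → (∀ i → V i zero ≡ 1ℚ) → ∀ y → Cone P V y → 0ℚ ≤ y zero
cone-height P {k = zero}  V V₀≡1 y c = ℚP.≤-reflexive (sym (c zero))
cone-height P {k = suc k} V V₀≡1 y (t , t>0 , c) =
  subst (0ℚ ≤_) (trans (cong (λ q → (y zero - t * q) + t) (V₀≡1 zero)) (lemma (y zero) t))
    (ℚP.+-mono-≤ (cone-height P (V ∘ suc) (V₀≡1 ∘ suc) (y −[ t ] V zero) c) (Positivity.pos⇒≥0 P t>0))
  where
  lemma : ∀ y t → (y - t * 1ℚ) + t ≡ y
  lemma = solve-∀ ℚ-ring

spanned-fibred : ∀ {d k} (V : Fin (suc k) → Vector (suc d)) → (∀ i → V i zero ≡ 1ℚ) → (𝓓 : Description (V ∘ suc))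
  (Ev≡0 : All (λ a → dot a (V zero) ≡ 0ℚ) (Description.E 𝓓)) → Fibred V 𝓓 (Spanned.describe V 𝓓 Ev≡0)
spanned-fibred {d} V V₀≡1 𝓓′ Ev≡0 = record { closed = closed ; open′ = open′ }
  where
  open Spanned V 𝓓′ Ev≡0
  open Description
  v : Vector (suc d)
  v = V zero
  -- Heights in the cone are nonnegative and v has height 1, so t is at most the height of y. Adding
  -- 1 makes the bound strict, as `positive` demands.
  below-top : ∀ P y t → Cone P (V ∘ suc) (y −[ t ] v) → Positivity.Pos P ((y zero + 1ℚ) - t)
  below-top P y t c = Positivity.>0⇒pos P (subst (0ℚ <_)
    (trans (cong (λ q → (y zero - t * q) + 1ℚ) (V₀≡1 zero)) (lemma (y zero) t))
    (ℚP.+-mono-≤-< (cone-height P (V ∘ suc) (V₀≡1 ∘ suc) (y −[ t ] v) c) 0<1))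
    where
    lemma : ∀ y t → (y - t * 1ℚ) + 1ℚ ≡ (y + 1ℚ) - t
    lemma = solve-∀ ℚ-ring
  closed : ∀ y → EulerIntegral (λ t → [≥0] t * [cone] 𝓓′ (y −[ t ] v)) ([cone] describe y)
  closed y with cone? describe y
  ... | no ¬c = closed-empty V 𝓓′ y ¬c
  ... | yes (u , u≥0 , cu) =
    let (a , b , to , from) = slice nonnegative (cone 𝓓′) y (y zero + 1ℚ) u (below-top nonnegative y) u≥0 cu in
    closed-fibre V 𝓓′ y (u , u≥0 , cu) a b
      (λ t t≥0 c → let (p , q) = to t t≥0 c in 0≤q-p⇒p≤q p , 0≤q-p⇒p≤q q)
      (λ t a≤t t≤b → from t (p≤q⇒0≤q-p a≤t) (p≤q⇒0≤q-p t≤b))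
  sign : ∀ e → - e * - 1ℚ ≡ e * 1ℚ
  sign = solve-∀ ℚ-ring
  open′ : ∀ y → EulerIntegral (λ t → ([≥0] t - 1ℚ) * [-interior] 𝓓′ (y −[ t ] v)) ([-interior] describe y)
  open′ y with interior? describe (neg y)
  ... | no ¬c = subst (EulerIntegral _) (sym (ℚP.*-zeroʳ (ε describe))) (open-empty V 𝓓′ y ¬c)
  ... | yes (u , u>0 , cu) =
    let (a , b , to , from) = slice positive (interior 𝓓′) (neg y) (neg y zero + 1ℚ) u (below-top positive (neg y)) u>0 cu
        (p , q) = to u u>0 cu in
    subst (EulerIntegral _) (sign (ε 𝓓′)) (open-interval V 𝓓′ y a b
      (ℚP.<-trans (0<q-p⇒p<q p) (0<q-p⇒p<q q))
      (λ t t>0 c → let (p , q) = to t t>0 c in 0<q-p⇒p<q p , 0<q-p⇒p<q q)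
      (λ t a<t t<b → from t (p<q⇒0<q-p a<t) (p<q⇒0<q-p t<b)))

extend : ∀ {d k} (V : Fin (suc k) → Vector (suc d)) → (∀ i → V i zero ≡ 1ℚ) → (𝓓 : Description (V ∘ suc)) →
  Σ (Description V) (Fibred V 𝓓)
extend V V₀≡1 𝓓 with All.all? (λ a → dot a (V zero) ℚP.≟ 0ℚ) (Description.E 𝓓)
... | yes Ev≡0 = Spanned.describe V 𝓓 Ev≡0 , spanned-fibred V V₀≡1 𝓓 Ev≡0
... | no  Ev≢0 with find (AllP.¬All⇒Any¬ (λ a → dot a (V zero) ℚP.≟ 0ℚ) _ Ev≢0)
...   | ℓ , ℓ∈E , ℓv≢0 with inverse ℓv≢0
...     | c , inv = Transversal.describe V 𝓓 ℓ∈E c inv , transversal-fibred V 𝓓 ℓ∈E c inv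

-- Without generators both cones are the origin and the sign is 1, so the two terms cancel.
∇-reciprocal-empty : ∀ {D} (V : Fin 0 → Vector D) y → reciprocal (describe-empty V) y ≡ 0ℚ
∇-reciprocal-empty V y = trans
  (cong (λ q → [cone] 𝓓 y - q) (trans (ℚP.*-identityˡ _) (ind-cong (interior? (neg y)) (cone? y)
    (λ c j → trans (negneg (y j)) (cong -_ (c j))) (λ c j → cong -_ (c j)))))
  (ℚP.+-inverseʳ ([cone] 𝓓 y))
  where
  𝓓 : Description V
  𝓓 = describe-empty V
  open Description 𝓓
  negneg : ∀ t → t ≡ - - t
  negneg = solve-∀ ℚ-ring

cone-reciprocity : ∀ {d k} (V : Fin k → Vector (suc d)) → (∀ i → V i zero ≡ 1ℚ) →
  Σ (Description V) λ 𝓓 → ∀ y → ∇ V (reciprocal 𝓓) y ≡ 0ℚ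
cone-reciprocity {k = zero}  V V₀≡1 = describe-empty V , ∇-reciprocal-empty V
cone-reciprocity {k = suc k} V V₀≡1 =
  let (𝓓′ , ih)  = cone-reciprocity (V ∘ suc) (V₀≡1 ∘ suc)
      (𝓓 , fib) = extend V V₀≡1 𝓓′
  in 𝓓 , ∇-reciprocal-step V fib ih

-- The embedding of ℤ in ℚ

private
  -- The quotient z / 1 is normalised through a gcd and is stuck for a variable z. This is its
  -- normal form, on which sums and products compute.
  integer : ℤ → ℚ
  integer z = mkℚ z 0 (Coprimality.sym (Coprimality.1-coprimeTo ∣ z ∣))

  ℤ→ℚ≡integer : ∀ z → ℤ→ℚ z ≡ integer z
  ℤ→ℚ≡integer z = ℚP.fromℚᵘ-toℚᵘ (integer z)

ℤ→ℚ-+ : ∀ a b → ℤ→ℚ (a ℤ.+ b) ≡ ℤ→ℚ a + ℤ→ℚ b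
ℤ→ℚ-+ a b = sym (trans (cong₂ _+_ (ℤ→ℚ≡integer a) (ℤ→ℚ≡integer b))
  (cong ℤ→ℚ (cong₂ ℤ._+_ (ℤP.*-identityʳ a) (ℤP.*-identityʳ b))))

ℤ→ℚ-* : ∀ a b → ℤ→ℚ (a ℤ.* b) ≡ ℤ→ℚ a * ℤ→ℚ b
ℤ→ℚ-* a b = sym (cong₂ _*_ (ℤ→ℚ≡integer a) (ℤ→ℚ≡integer b))

ℤ→ℚ-neg : ∀ a → ℤ→ℚ (ℤ.- a) ≡ - ℤ→ℚ a
ℤ→ℚ-neg a = trans (cong ℤ→ℚ (sym (ℤP.-1*i≡-i a))) (trans (ℤ→ℚ-* (ℤ.- 1ℤ) a) (lemma (ℤ→ℚ a)))
  where
  lemma : ∀ q → - 1ℚ * q ≡ - q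
  lemma = solve-∀ ℚ-ring

ℤ→ℚ-- : ∀ a b → ℤ→ℚ (a ℤ.- b) ≡ ℤ→ℚ a - ℤ→ℚ b
ℤ→ℚ-- a b = trans (ℤ→ℚ-+ a (ℤ.- b)) (cong (ℤ→ℚ a +_) (ℤ→ℚ-neg b))

ℤ→ℚ-cancel-≤ : ∀ {a b} → ℤ→ℚ a ≤ ℤ→ℚ b → a ℤ.≤ b
ℤ→ℚ-cancel-≤ {a} {b} a≤b = subst₂ ℤ._≤_ (ℤP.*-identityʳ a) (ℤP.*-identityʳ b)
  (ℚP.drop-*≤* (subst₂ _≤_ (ℤ→ℚ≡integer a) (ℤ→ℚ≡integer b) a≤b))

ℤ→ℚ-mono-≤ : ∀ {a b} → a ℤ.≤ b → ℤ→ℚ a ≤ ℤ→ℚ b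
ℤ→ℚ-mono-≤ {a} {b} a≤b = subst₂ _≤_ (sym (ℤ→ℚ≡integer a)) (sym (ℤ→ℚ≡integer b))
  (ℚ.*≤* (subst₂ ℤ._≤_ (sym (ℤP.*-identityʳ a)) (sym (ℤP.*-identityʳ b)) a≤b))

-- Functions on ℤ annihilated by a power of the difference operator

diff : (ℤ → ℚ) → ℤ → ℚ
diff f n = f n - f (n ℤ.- 1ℤ)

-- A stand-in for polynomials of degree below k. It applies to functions known only through their
-- differences, without exhibiting coefficients.
DegreeBelow : ℕ → (ℤ → ℚ) → Set
DegreeBelow zero    f = ∀ n → f n ≡ 0ℚ
DegreeBelow (suc k) f = DegreeBelow k (diff f)

degree-cong : ∀ k {f g} → (∀ n → f n ≡ g n) → DegreeBelow k f → DegreeBelow k g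
degree-cong zero    eq p n = trans (sym (eq n)) (p n)
degree-cong (suc k) eq p   = degree-cong k (λ n → cong₂ _-_ (eq n) (eq (n ℤ.- 1ℤ))) p

degree-zero : ∀ k {f} → (∀ n → f n ≡ 0ℚ) → DegreeBelow k f
degree-zero zero    f≗0 = f≗0
degree-zero (suc k) f≗0 = degree-zero k (λ n → cong₂ _-_ (f≗0 n) (f≗0 (n ℤ.- 1ℤ)))

degree-+ : ∀ k {f g} → DegreeBelow k f → DegreeBelow k g → DegreeBelow k (λ n → f n + g n)
degree-+ zero    p q n = cong₂ _+_ (p n) (q n)
degree-+ (suc k) {f} {g} p q =
  degree-cong k (λ n → lemma (f n) (f (n ℤ.- 1ℤ)) (g n) (g (n ℤ.- 1ℤ))) (degree-+ k p q)
  where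
  lemma : ∀ a b c d → (a - b) + (c - d) ≡ (a + c) - (b + d)
  lemma = solve-∀ ℚ-ring

degree-* : ∀ k c {f} → DegreeBelow k f → DegreeBelow k (λ n → c * f n)
degree-* zero    c p n = trans (cong (c *_) (p n)) (ℚP.*-zeroʳ c)
degree-* (suc k) c {f} p = degree-cong k (λ n → lemma c (f n) (f (n ℤ.- 1ℤ))) (degree-* k c p)
  where
  lemma : ∀ c a b → c * (a - b) ≡ c * a - c * b
  lemma = solve-∀ ℚ-ring

degree-shift : ∀ k {f} → DegreeBelow k f → DegreeBelow k (λ n → f (n ℤ.- 1ℤ))
degree-shift zero    p n = p (n ℤ.- 1ℤ)
degree-shift (suc k) p   = degree-shift k p

degree-suc : ∀ k {f} → DegreeBelow k f → DegreeBelow (suc k) f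
degree-suc zero    p   = λ n → cong₂ _-_ (p n) (p (n ℤ.- 1ℤ))
degree-suc (suc k) p   = degree-suc k p

degree-weaken : ∀ j k {f} → DegreeBelow k f → DegreeBelow (j ℕ.+ k) f
degree-weaken zero    k p = p
degree-weaken (suc j) k p = degree-suc (j ℕ.+ k) (degree-weaken j k p)

-- n f(n) − (n−1) f(n−1) = n (f(n) − f(n−1)) + f(n−1)
degree-id* : ∀ k {f} → DegreeBelow k f → DegreeBelow (suc k) (λ n → ℤ→ℚ n * f n)
degree-id* zero    p = degree-zero 1 (λ n → trans (cong (ℤ→ℚ n *_) (p n)) (ℚP.*-zeroʳ (ℤ→ℚ n)))
degree-id* (suc k) {f} p = degree-cong (suc k)
  (λ n → trans (lemma (ℤ→ℚ n) (f n) (f (n ℤ.- 1ℤ)))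
    (cong (λ q → ℤ→ℚ n * f n - q * f (n ℤ.- 1ℤ)) (sym (ℤ→ℚ-- n 1ℤ))))
  (degree-+ (suc k) {λ n → ℤ→ℚ n * diff f n} {λ n → f (n ℤ.- 1ℤ)} (degree-id* k p) (degree-shift (suc k) {f} p))
  where
  lemma : ∀ n a b → n * (a - b) + b ≡ n * a - (n - 1ℚ) * b
  lemma = solve-∀ ℚ-ring

degree-power : ∀ i → DegreeBelow (suc i) (λ n → ℤ→ℚ n ^ℚ i)
degree-power zero    = λ n → ℚP.+-inverseʳ 1ℚ
degree-power (suc i) = degree-id* (suc i) (degree-power i)

degree-sum : ∀ k {r} (f : Fin r → ℤ → ℚ) → (∀ i → DegreeBelow k (f i)) → DegreeBelow k (λ n → Σℚ (λ i → f i n))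
degree-sum k {zero}  f p = degree-zero k (λ n → refl)
degree-sum k {suc r} f p = degree-+ k (p zero) (degree-sum k (f ∘ suc) (p ∘ suc))

degree-polynomial : ∀ {r} (e : Fin r → ℚ) → DegreeBelow r (λ n → Σℚ (λ i → e i * (ℤ→ℚ n ^ℚ toℕ i)))
degree-polynomial {r} e = degree-sum r (λ i n → e i * (ℤ→ℚ n ^ℚ toℕ i)) (λ i → degree-* r (e i)
  (subst (λ k → DegreeBelow k (λ n → ℤ→ℚ n ^ℚ toℕ i)) (ℕP.m∸n+n≡m (FinP.toℕ<n i))
    (degree-weaken (r ℕ.∸ suc (toℕ i)) (suc (toℕ i)) (degree-power (toℕ i)))))

i≤∣i∣ : ∀ i → i ℤ.≤ ℤ.+ ∣ i ∣
i≤∣i∣ (ℤ.+ n)      = ℤP.≤-refl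
i≤∣i∣ (ℤ.-[1+ n ]) = ℤ.-≤+

-- The difference of f vanishes from a + 1 on, hence everywhere by induction; so f is constant, and
-- it is zero far to the right. This carries identities from positive to negative integers.
degree-vanishing : ∀ k {f} → DegreeBelow k f → ∀ a → (∀ n → a ℤ.≤ n → f n ≡ 0ℚ) → ∀ n → f n ≡ 0ℚ
degree-vanishing zero    p a f≡0 n = p n
degree-vanishing (suc k) {f} p a f≡0 n =
  -- The climb by |a - n| steps ends at an integer that is at least a.
  trans (climb ∣ a ℤ.- n ∣) (f≡0 _ (subst (ℤ._≤ n ℤ.+ ℤ.+ ∣ a ℤ.- n ∣) (cancel n a) (ℤP.+-monoʳ-≤ n (i≤∣i∣ (a ℤ.- n)))))
  where
  cancel : ∀ n a → n ℤ.+ (a ℤ.- n) ≡ a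
  cancel = solve-ℤ
  cancel′ : ∀ a → (a ℤ.+ 1ℤ) ℤ.- 1ℤ ≡ a
  cancel′ = solve-ℤ
  pred-suc : ∀ n j → (n ℤ.+ (1ℤ ℤ.+ j)) ℤ.- 1ℤ ≡ n ℤ.+ j
  pred-suc = solve-ℤ
  diff≡0 : ∀ n → diff f n ≡ 0ℚ
  diff≡0 = degree-vanishing k p (a ℤ.+ 1ℤ) (λ m a+1≤m → cong₂ _-_
    (f≡0 m (ℤP.≤-trans (ℤP.i≤i+j a 1ℤ) a+1≤m))
    (f≡0 (m ℤ.- 1ℤ) (subst (ℤ._≤ m ℤ.- 1ℤ) (cancel′ a) (ℤP.+-monoˡ-≤ (ℤ.- 1ℤ) a+1≤m))))
  step : ∀ m → f m ≡ f (m ℤ.- 1ℤ)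
  step m = trans (lemma (f m) (f (m ℤ.- 1ℤ))) (trans (cong (_+ f (m ℤ.- 1ℤ)) (diff≡0 m)) (ℚP.+-identityˡ _))
    where
    lemma : ∀ a b → a ≡ (a - b) + b
    lemma = solve-∀ ℚ-ring
  climb : ∀ j → f n ≡ f (n ℤ.+ ℤ.+ j)
  climb zero    = cong f (sym (ℤP.+-identityʳ n))
  climb (suc j) = trans (climb j) (sym (trans (step (n ℤ.+ ℤ.+ suc j)) (cong f (pred-suc n (ℤ.+ j)))))

-- Finite sums over lattice points

∑-one : ∀ {A : Set} (L : List A) → ∑ (λ _ → 1ℚ) L ≡ ℕ→ℚ (length L)
∑-one []      = refl
∑-one (x ∷ L) = trans (cong (1ℚ +_) (∑-one L)) (sym (ℤ→ℚ-+ 1ℤ (ℤ.+ length L)))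

module _ {A : Set} (_≟_ : DecidableEquality A) where

  hasSum-finite : ∀ {f : A → ℚ} L → (∀ x → x ∈ L ⊎ f x ≡ 0ℚ) → ∃[ c ] HasSum _≟_ f c
  hasSum-finite L s = _ , List.deduplicate _≟_ L , UniqueDec.deduplicate-! _≟_ L ,
    (λ x → Sum.map₁ (∈-deduplicate⁺ _≟_) (s x)) , refl

  hasSum-reindex : ∀ {f : A → ℚ} {c} (σ ρ : A → A) → (∀ x → σ (ρ x) ≡ x) → (∀ x → ρ (σ x) ≡ x) →
    HasSum _≟_ f c → HasSum _≟_ (f ∘ σ) c
  hasSum-reindex {f} σ ρ σρ ρσ (L , uL , sL , eq) = map ρ L ,
    UniqueP.map⁺ (λ {x} {y} ρx≡ρy → trans (sym (σρ x)) (trans (cong σ ρx≡ρy) (σρ y))) uL ,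
    (λ x → Sum.map₁ (λ σx∈L → subst (_∈ map ρ L) (ρσ x) (∈-map⁺ ρ σx∈L)) (sL (σ x))) ,
    trans (∑-map ρ (f ∘ σ) L) (trans (∑-cong L (λ x _ → cong f (σρ x))) eq)

  card⇒hasSum : ∀ {S : A → Set} (S? : ∀ x → Dec (S x)) {L} → Unique L → (∀ x → (x ∈ L) ⇔ S x) →
    HasSum _≟_ (ind ∘ S?) (ℕ→ℚ (length L))
  card⇒hasSum S? {L} uL L⇔S = L , uL , support ,
    trans (∑-cong L (λ x x∈L → ind-yes (S? x) (Equivalence.to (L⇔S x) x∈L))) (∑-one L)
    where
    support : ∀ x → x ∈ L ⊎ ind (S? x) ≡ 0ℚ
    support x with S? x
    ... | yes s = inj₁ (Equivalence.from (L⇔S x) s)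
    ... | no  _ = inj₂ refl

_≟ᵛ_ : ∀ {d} → DecidableEquality (Vec ℤ d)
_≟ᵛ_ = VecP.≡-dec ℤP._≟_

hasCard⇒hasSum : ∀ {d} {S : Pt d → Set} (S? : ∀ (x : Vec ℤ d) → Dec (S (lookup x))) {k} → HasCard S k →
  HasSum _≟ᵛ_ (ind ∘ S?) (ℕ→ℚ k)
hasCard⇒hasSum S? (L , uL , L⇔S , refl) = card⇒hasSum _≟ᵛ_ S? uL L⇔S

hasCard-finite : ∀ {d} {S : Pt d → Set} → (∀ (x : Vec ℤ d) → Dec (S (lookup x))) → ∀ L →
  (∀ x → S (lookup x) → x ∈ L) → ∃[ k ] HasCard S k
hasCard-finite S? L S⊆L = _ , filter S? M , UniqueP.filter⁺ S? (UniqueDec.deduplicate-! _≟ᵛ_ L) ,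
  (λ x → mk⇔ (λ x∈ → proj₂ (∈-filter⁻ S? {xs = M} x∈))
             (λ s → ∈-filter⁺ S? (∈-deduplicate⁺ _≟ᵛ_ (S⊆L x s)) s)) , refl
  where M = List.deduplicate _≟ᵛ_ L

-- The integer 0 is listed twice; duplicates are removed where the box is used.
integersUpTo : ℕ → List ℤ
integersUpTo B = map ℤ.+_ (upTo (suc B)) ++ map (λ n → ℤ.- (ℤ.+ n)) (upTo (suc B))

∈-integersUpTo : ∀ {B} z → ∣ z ∣ ℕ.≤ B → z ∈ integersUpTo B
∈-integersUpTo (ℤ.+ n) n≤B = ∈-++⁺ˡ (∈-map⁺ ℤ.+_ (∈-upTo⁺ (s≤s n≤B)))
∈-integersUpTo {B} (ℤ.-[1+ n ]) n<B = ∈-++⁺ʳ (map ℤ.+_ (upTo (suc B))) (∈-map⁺ (λ n → ℤ.- (ℤ.+ n)) (∈-upTo⁺ (s≤s n<B)))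

box : ∀ d → ℕ → List (Vec ℤ d)
box zero    B = [] ∷ []
box (suc d) B = cartesianProductWith _∷_ (integersUpTo B) (box d B)

∈-box : ∀ {d B} (x : Vec ℤ d) → (∀ j → ∣ lookup x j ∣ ℕ.≤ B) → x ∈ box d B
∈-box []      _  = here refl
∈-box (z ∷ x) le = ∈-cartesianProductWith⁺ _∷_ (∈-integersUpTo z (le zero)) (∈-box x (le ∘ suc))

-- Lattice points at a fixed height

hom : ∀ {d} → ℤ → Pt d → Vector (suc d)
hom n x zero    = ℤ→ℚ n
hom n x (suc j) = ℤ→ℚ (x j)

translate : ∀ {d} → Pt d → Vec ℤ d → Vec ℤ d
translate w x = Vec.tabulate (λ j → lookup x j ℤ.+ w j)

lookup-ext : ∀ {A : Set} {d} {x y : Vec A d} → (∀ j → lookup x j ≡ lookup y j) → x ≡ y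
lookup-ext {x = []}    {[]}    eq = refl
lookup-ext {x = _ ∷ _} {_ ∷ _} eq = cong₂ _∷_ (eq zero) (lookup-ext (eq ∘ suc))

translate-inverse : ∀ {d} (w u : Pt d) → (∀ j → u j ≡ ℤ.- w j) → ∀ x → translate w (translate u x) ≡ x
translate-inverse w u u≡-w x = lookup-ext (λ j → begin
  lookup (translate w (translate u x)) j ≡⟨ VecP.lookup∘tabulate _ j ⟩
  lookup (translate u x) j ℤ.+ w j       ≡⟨ cong (ℤ._+ w j) (VecP.lookup∘tabulate _ j) ⟩
  (lookup x j ℤ.+ u j) ℤ.+ w j           ≡⟨ cong (λ z → (lookup x j ℤ.+ z) ℤ.+ w j) (u≡-w j) ⟩
  (lookup x j ℤ.+ ℤ.- w j) ℤ.+ w j       ≡⟨ lemma (lookup x j) (w j) ⟩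
  lookup x j                             ∎)
  where
  lemma : ∀ x w → (x ℤ.+ ℤ.- w) ℤ.+ w ≡ x
  lemma = solve-ℤ

hom-translate : ∀ {d} n (w : Pt d) x → hom n (lookup x) −[ 1ℚ ] hom 1ℤ w ≗ hom (n ℤ.- 1ℤ) (lookup (translate (λ j → ℤ.- w j) x))
hom-translate n w x zero    = trans (cong (λ z → ℤ→ℚ n - z) (ℚP.*-identityˡ 1ℚ)) (sym (ℤ→ℚ-- n 1ℤ))
hom-translate n w x (suc j) = trans (cong (λ z → ℤ→ℚ (lookup x j) - z) (ℚP.*-identityˡ (ℤ→ℚ (w j))))
  (trans (sym (ℤ→ℚ-- (lookup x j) (w j))) (cong ℤ→ℚ (sym (VecP.lookup∘tabulate _ j))))

-- Translation by (1, w) permutes the lattice points apart from lowering the height by one. A sum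
-- over all lattice points of a given height only sees the latter, so every ∇ becomes one `diff`.
lattice-degree : ∀ {d k} (v : Fin k → Pt d) {φ : Vector (suc d) → ℚ} → Extensional φ →
  {G : ℤ → ℚ} → (∀ n → HasSum _≟ᵛ_ (λ x → φ (hom n (lookup x))) (G n)) →
  (∀ y → ∇ (λ i → hom 1ℤ (v i)) φ y ≡ 0ℚ) → DegreeBelow k G
lattice-degree {k = zero}  v ext sums φ≡0 n = hasSum-zero _≟ᵛ_ (λ x → φ≡0 (hom n (lookup x))) (sums n)
lattice-degree {k = suc k} v {φ} ext {G} sums ∇φ≡0 = lattice-degree (v ∘ suc)
  (λ y≗z → cong₂ _-_ (ext y≗z) (ext (λ j → cong (_- 1ℚ * w j) (y≗z j)))) sums′ ∇φ≡0
  where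
  w = hom 1ℤ (v zero)
  lemma : ∀ b → - 1ℚ * b ≡ - b
  lemma = solve-∀ ℚ-ring
  shifted : ∀ n → HasSum _≟ᵛ_ (λ x → φ (hom n (lookup x) −[ 1ℚ ] w)) (G (n ℤ.- 1ℤ))
  shifted n = hasSum-cong _≟ᵛ_ (λ x → ext (sym ∘ hom-translate n (v zero) x))
    (hasSum-reindex _≟ᵛ_ (translate (λ j → ℤ.- v zero j)) (translate (v zero))
      (translate-inverse _ _ (λ j → sym (ℤP.neg-involutive (v zero j))))
      (translate-inverse _ _ (λ j → refl)) (sums (n ℤ.- 1ℤ)))
  sums′ : ∀ n → HasSum _≟ᵛ_ (λ x → φ (hom n (lookup x)) - φ (hom n (lookup x) −[ 1ℚ ] w)) (diff G n)
  sums′ n = subst (HasSum _≟ᵛ_ _) (cong (G n +_) (lemma (G (n ℤ.- 1ℤ))))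
    (hasSum-cong _≟ᵛ_ (λ x → cong (φ (hom n (lookup x)) +_) (lemma _))
      (hasSum-+ _≟ᵛ_ (sums n) (hasSum-* _≟ᵛ_ (- 1ℚ) (shifted n))))

-- Dilates as slices of cones, and bounds on their points

module _ (P : Positivity) where
  open Positivity P

  weights⁺ : ∀ {D k} (V : Fin k → Vector D) y → Cone P V y →
    Σ (Fin k → ℚ) λ μ → (∀ i → Pos (μ i)) × (∀ j → y j ≡ Σℚ (λ i → μ i * V i j))
  weights⁺ {k = zero}  V y c = (λ ()) , (λ ()) , c
  weights⁺ {k = suc k} V y (t , t>0 , c) with weights⁺ (V ∘ suc) (y −[ t ] V zero) c
  ... | μ , μ>0 , eq = μ′ , (λ { zero → t>0 ; (suc i) → μ>0 i }) ,
        (λ j → trans (lemma (y j) (t * V zero j)) (cong (t * V zero j +_) (eq j)))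
    where
    μ′ : Fin (suc k) → ℚ
    μ′ zero    = t
    μ′ (suc i) = μ i
    lemma : ∀ p q → p ≡ q + (p - q)
    lemma = solve-∀ ℚ-ring

  weights⁻ : ∀ {D k} (V : Fin k → Vector D) y (μ : Fin k → ℚ) → (∀ i → Pos (μ i)) →
    (∀ j → y j ≡ Σℚ (λ i → μ i * V i j)) → Cone P V y
  weights⁻ {k = zero}  V y μ μ>0 eq = eq
  weights⁻ {k = suc k} V y μ μ>0 eq = μ zero , μ>0 zero ,
    weights⁻ (V ∘ suc) (y −[ μ zero ] V zero) (μ ∘ suc) (μ>0 ∘ suc)
      (λ j → trans (cong (_- μ zero * V zero j) (eq j)) (lemma (μ zero * V zero j) _))
    where
    lemma : ∀ p q → (p + q) - p ≡ q
    lemma = solve-∀ ℚ-ring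

  -- InDilate and InDilateRelint are the instances nonnegative and positive.
  Dilate : ∀ {d m} → (Fin (suc m) → Pt d) → ℕ → Pt d → Set
  Dilate v n x = ∃[ λ' ] ((∀ i → Pos (λ' i)) × (Σℚ λ' ≡ 1ℚ) ×
                          (∀ j → ℤ→ℚ (x j) ≡ ℕ→ℚ n * Σℚ (λ i → λ' i * ℤ→ℚ (v i j))))

  private
    scaled-sum : ∀ {k} c (μ w : Fin k → ℚ) → Σℚ (λ i → (c * μ i) * w i) ≡ c * Σℚ (λ i → μ i * w i)
    scaled-sum c μ w = trans (Σℚ-cong (λ i → ℚP.*-assoc c (μ i) (w i))) (Σℚ-*ˡ c (λ i → μ i * w i))

  -- Convex weights are multiplied by n; the height coordinate then records that they add up to n.
  dilate⇒cone : ∀ {d m} (v : Fin (suc m) → Pt d) n x → 0ℚ < ℕ→ℚ n →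
    Dilate v n x → Cone P (λ i → hom 1ℤ (v i)) (hom (ℤ.+ n) x)
  dilate⇒cone v n x n>0 (μ , μ>0 , Σμ≡1 , eq) =
    weights⁻ (λ i → hom 1ℤ (v i)) (hom (ℤ.+ n) x) (λ i → ℕ→ℚ n * μ i) (λ i → pos-* n>0 (μ>0 i)) coordinates
    where
    coordinates : ∀ j → hom (ℤ.+ n) x j ≡ Σℚ (λ i → (ℕ→ℚ n * μ i) * hom 1ℤ (v i) j)
    coordinates zero    = sym (trans (scaled-sum (ℕ→ℚ n) μ (λ _ → 1ℚ))
      (trans (cong (ℕ→ℚ n *_) (trans (Σℚ-cong (λ i → ℚP.*-identityʳ (μ i))) Σμ≡1)) (ℚP.*-identityʳ (ℕ→ℚ n))))
    coordinates (suc j) = trans (eq j) (sym (scaled-sum (ℕ→ℚ n) μ (λ i → ℤ→ℚ (v i j))))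

  cone⇒dilate : ∀ {d m} (v : Fin (suc m) → Pt d) n x → 0ℚ < ℕ→ℚ n →
    Cone P (λ i → hom 1ℤ (v i)) (hom (ℤ.+ n) x) → Dilate v n x
  cone⇒dilate v n x n>0 cn with weights⁺ (λ i → hom 1ℤ (v i)) (hom (ℤ.+ n) x) cn | inverse-pos n>0
  ... | μ , μ>0 , eq | c , c>0 , inv = (λ i → c * μ i) , (λ i → pos-* c>0 (μ>0 i)) ,
    (begin
      Σℚ (λ i → c * μ i)             ≡⟨ Σℚ-*ˡ c μ ⟩
      c * Σℚ μ                       ≡⟨ cong (c *_) (Σℚ-cong (λ i → ℚP.*-identityʳ (μ i))) ⟨
      c * Σℚ (λ i → μ i * 1ℚ)        ≡⟨ cong (c *_) (eq zero) ⟨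
      c * ℕ→ℚ n                      ≡⟨ inv ⟩
      1ℚ                             ∎) ,
    (λ j → begin
      ℤ→ℚ (x j)                                             ≡⟨ ℚP.*-identityˡ _ ⟨
      1ℚ * ℤ→ℚ (x j)                                        ≡⟨ cong (_* ℤ→ℚ (x j)) inv ⟨
      (c * ℕ→ℚ n) * ℤ→ℚ (x j)                               ≡⟨ lemma c (ℕ→ℚ n) (ℤ→ℚ (x j)) ⟩
      ℕ→ℚ n * (c * ℤ→ℚ (x j))                               ≡⟨ cong (λ z → ℕ→ℚ n * (c * z)) (eq (suc j)) ⟩
      ℕ→ℚ n * (c * Σℚ (λ i → μ i * ℤ→ℚ (v i j)))            ≡⟨ cong (ℕ→ℚ n *_) (scaled-sum c μ (λ i → ℤ→ℚ (v i j))) ⟨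
      ℕ→ℚ n * Σℚ (λ i → (c * μ i) * ℤ→ℚ (v i j))            ∎)
    where
    lemma : ∀ c n x → (c * n) * x ≡ n * (c * x)
    lemma = solve-∀ ℚ-ring

  -- A linear functional only has to be checked on the generators. With a the radius and b = ±1 this
  -- confines each coordinate to at most the radius times the height.
  cone-bound : ∀ {d k} (V : Fin k → Vector (suc d)) a b j → (∀ i → 0ℚ ≤ a * V i zero + b * V i j) →
    ∀ y → Cone P V y → 0ℚ ≤ a * y zero + b * y j
  cone-bound {k = zero}  V a b j V≥0 y c =
    ℚP.≤-reflexive (sym (trans (cong₂ (λ p q → a * p + b * q) (c zero) (c j)) (lemma a b)))
    where
    lemma : ∀ a b → a * 0ℚ + b * 0ℚ ≡ 0ℚ
    lemma = solve-∀ ℚ-ring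
  cone-bound {k = suc k} V a b j V≥0 y (t , t>0 , c) =
    subst (0ℚ ≤_) (lemma a b (y zero) (y j) t (V zero zero) (V zero j))
      (ℚP.+-mono-≤ (cone-bound (V ∘ suc) a b j (V≥0 ∘ suc) (y −[ t ] V zero) c)
        (0≤c⇒0≤c*q (pos⇒≥0 t>0) (V≥0 zero)))
    where
    lemma : ∀ a b y₀ y t v₀ v → (a * (y₀ - t * v₀) + b * (y - t * v)) + t * (a * v₀ + b * v) ≡ a * y₀ + b * y
    lemma = solve-∀ ℚ-ring

total : ∀ {k} → (Fin k → ℕ) → ℕ
total {zero}  f = 0
total {suc k} f = f zero ℕ.+ total (f ∘ suc)

≤-total : ∀ {k} (f : Fin k → ℕ) i → f i ℕ.≤ total f
≤-total f zero    = ℕP.m≤m+n (f zero) _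
≤-total f (suc i) = ℕP.≤-trans (≤-total (f ∘ suc) i) (ℕP.m≤n+m _ (f zero))

radius : ∀ {d k} → (Fin k → Pt d) → ℕ
radius v = total (λ i → total (λ j → ∣ v i j ∣))

∣z∣≤∣a∣ : ∀ a z → 0ℤ ℤ.≤ a ℤ.+ z → 0ℤ ℤ.≤ a ℤ.- z → ∣ z ∣ ℕ.≤ ∣ a ∣
∣z∣≤∣a∣ a z a+z≥0 a-z≥0 with ℤP.+∣i∣≡i⊎+∣i∣≡-i z
... | inj₁ eq = ℤP.drop‿+≤+ (subst (ℤ._≤ ℤ.+ ∣ a ∣) (sym eq) (ℤP.≤-trans (ℤP.0≤i-j⇒j≤i a-z≥0) (i≤∣i∣ a)))
... | inj₂ eq = ℤP.drop‿+≤+ (subst (ℤ._≤ ℤ.+ ∣ a ∣) (sym eq) (ℤP.≤-trans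
    (ℤP.0≤i-j⇒j≤i (subst (0ℤ ℤ.≤_) (cong (λ i → a ℤ.+ i) (sym (ℤP.neg-involutive z))) a+z≥0)) (i≤∣i∣ a)))

-i≤∣i∣ : ∀ i → ℤ.- i ℤ.≤ ℤ.+ ∣ i ∣
-i≤∣i∣ i = subst (λ n → ℤ.- i ℤ.≤ ℤ.+ n) (ℤP.∣-i∣≡∣i∣ i) (i≤∣i∣ (ℤ.- i))

hom-bound : ∀ P {d k} (v : Fin k → Pt d) n (x : Pt d) → Cone P (λ i → hom 1ℤ (v i)) (hom n x) →
  ∀ j → ∣ x j ∣ ℕ.≤ ∣ ℤ.+ radius v ℤ.* n ∣
hom-bound P v n x c j = ∣z∣≤∣a∣ (R ℤ.* n) (x j) upper lower
  where
  R = ℤ.+ radius v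
  coordinate≤R : ∀ i → ∣ v i j ∣ ℕ.≤ radius v
  coordinate≤R i = ℕP.≤-trans (≤-total (λ j → ∣ v i j ∣) j) (≤-total (λ i → total (λ j → ∣ v i j ∣)) i)
  combine : ∀ b n z → ℤ→ℚ R * ℤ→ℚ n + ℤ→ℚ b * ℤ→ℚ z ≡ ℤ→ℚ (R ℤ.* n ℤ.+ b ℤ.* z)
  combine b n z = sym (trans (ℤ→ℚ-+ (R ℤ.* n) (b ℤ.* z)) (cong₂ _+_ (ℤ→ℚ-* R n) (ℤ→ℚ-* b z)))
  bound : ∀ b → (∀ i → 0ℤ ℤ.≤ R ℤ.* 1ℤ ℤ.+ b ℤ.* v i j) → 0ℤ ℤ.≤ R ℤ.* n ℤ.+ b ℤ.* x j
  bound b v≥0 = ℤ→ℚ-cancel-≤ (subst (0ℚ ≤_) (combine b n (x j))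
    (cone-bound P (λ i → hom 1ℤ (v i)) (ℤ→ℚ R) (ℤ→ℚ b) (suc j)
      (λ i → subst (0ℚ ≤_) (sym (combine b 1ℤ (v i j))) (ℤ→ℚ-mono-≤ (v≥0 i))) (hom n x) c))
  upper : 0ℤ ℤ.≤ R ℤ.* n ℤ.+ x j
  upper = subst (0ℤ ℤ.≤_) (cong (λ i → R ℤ.* n ℤ.+ i) (ℤP.*-identityˡ (x j)))
    (bound 1ℤ (λ i → subst (0ℤ ℤ.≤_) (lemma R (v i j))
      (ℤP.i≤j⇒0≤j-i (ℤP.≤-trans (-i≤∣i∣ (v i j)) (ℤ.+≤+ (coordinate≤R i))))))
    where
    lemma : ∀ r z → r ℤ.- ℤ.- z ≡ r ℤ.* 1ℤ ℤ.+ 1ℤ ℤ.* z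
    lemma = solve-ℤ
  lower : 0ℤ ℤ.≤ R ℤ.* n ℤ.- x j
  lower = subst (0ℤ ℤ.≤_) (cong (λ i → R ℤ.* n ℤ.+ i) (ℤP.-1*i≡-i (x j)))
    (bound (ℤ.- 1ℤ) (λ i → subst (0ℤ ℤ.≤_) (lemma R (v i j))
      (ℤP.i≤j⇒0≤j-i (ℤP.≤-trans (i≤∣i∣ (v i j)) (ℤ.+≤+ (coordinate≤R i))))))
    where
    lemma : ∀ r z → r ℤ.- z ≡ r ℤ.* 1ℤ ℤ.+ (ℤ.- 1ℤ) ℤ.* z
    lemma = solve-ℤ

cone∈box : ∀ P {d k} (v : Fin k → Pt d) n x → Cone P (λ i → hom 1ℤ (v i)) (hom n (lookup x)) →
  x ∈ box d ∣ ℤ.+ radius v ℤ.* n ∣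
cone∈box P v n x c = ∈-box x (hom-bound P v n (lookup x) c)

-- Linear independence and the rank

Independent : ∀ {D k} → (Fin k → Vector D) → Set
Independent {k = k} W = ∀ (μ : Fin k → ℚ) → (∀ j → Σℚ (λ i → μ i * W i j) ≡ 0ℚ) → ∀ i → μ i ≡ 0ℚ

-- Cuts an independent family that is too long down to the exact size r + 2 excluded by `Dim`.
independent-drop : ∀ {D} j {k} (W : Fin (j ℕ.+ k) → Vector D) → Independent W → Independent (W ∘ (j ↑ʳ_))
independent-drop zero    W ind      = ind
independent-drop (suc j) W ind = independent-drop j (W ∘ suc) tail
  where
  tail : Independent (W ∘ suc)
  tail μ rel i = ind μ′ (λ l → trans (cong (_+ Σℚ (λ i → μ i * W (suc i) l)) (ℚP.*-zeroˡ (W zero l)))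
    (trans (ℚP.+-identityˡ _) (rel l))) (suc i)
    where
    μ′ : Fin _ → ℚ
    μ′ zero    = 0ℚ
    μ′ (suc i) = μ i

-- Gaussian elimination: the first row clears one column of the others.
dependence : ∀ n {ρ} (c : Fin (suc n) → Fin ρ → ℚ) → ρ ℕ.≤ n →
  Σ (Fin (suc n) → ℚ) λ μ → ∃[ i ] (μ i ≢ 0ℚ) × (∀ l → Σℚ (λ i → μ i * c i l) ≡ 0ℚ)
dependence n {ρ} c ρ≤n with FinP.all? (λ l → c zero l ℚP.≟ 0ℚ)
... | yes c₀≡0 = unit zero , zero , (λ ()) , λ l → trans
  (cong₂ _+_ (trans (ℚP.*-identityˡ (c zero l)) (c₀≡0 l)) (Σℚ-zero (λ i → ℚP.*-zeroˡ (c (suc i) l)))) refl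
dependence _       {zero}  c _ | no c₀≢0 = contradiction (λ ()) c₀≢0
dependence (suc n) {suc ρ} c (s≤s ρ≤n) | no c₀≢0 with FinP.¬∀⟶∃¬ (suc ρ) _ (λ l → c zero l ℚP.≟ 0ℚ) c₀≢0
... | q , c₀q≢0 with inverse c₀q≢0
... | b , inv with dependence n (λ i l → c (suc i) (punchIn q l) - (b * c (suc i) q) * c zero (punchIn q l)) ρ≤n
... | μ , i , μi≢0 , rel = μ′ , suc i , μi≢0 , rel′
  where
  a : Fin (suc n) → ℚ
  a i = b * c (suc i) q
  μ′ : Fin (suc (suc n)) → ℚ
  μ′ zero    = - Σℚ (λ i → μ i * a i)
  μ′ (suc i) = μ i
  cleared : ∀ l → Σℚ (λ i → μ i * (c (suc i) l - a i * c zero l)) ≡ 0ℚ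
  cleared l with q FinP.≟ l
  ... | yes refl = Σℚ-zero (λ i → trans (cong (μ i *_) (trans (lemma (c (suc i) q) b (c zero q))
          (trans (cong (λ z → c (suc i) q - z * c (suc i) q) inv) (lemma′ (c (suc i) q))))) (ℚP.*-zeroʳ (μ i)))
    where
    lemma : ∀ x b y → x - (b * x) * y ≡ x - (b * y) * x
    lemma = solve-∀ ℚ-ring
    lemma′ : ∀ x → x - 1ℚ * x ≡ 0ℚ
    lemma′ = solve-∀ ℚ-ring
  ... | no q≢l = subst (λ l → Σℚ (λ i → μ i * (c (suc i) l - a i * c zero l)) ≡ 0ℚ)
          (FinP.punchIn-punchOut q≢l) (rel (punchOut q≢l))
  rel′ : ∀ l → Σℚ (λ i → μ′ i * c i l) ≡ 0ℚ
  rel′ l = begin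
    - Σℚ (λ i → μ i * a i) * c zero l + Σℚ (λ i → μ i * c (suc i) l)
      ≡⟨ lemma (Σℚ (λ i → μ i * a i)) (c zero l) _ ⟩
    Σℚ (λ i → μ i * c (suc i) l) + - c zero l * Σℚ (λ i → μ i * a i)
      ≡⟨ cong (Σℚ (λ i → μ i * c (suc i) l) +_) (Σℚ-*ˡ (- c zero l) (λ i → μ i * a i)) ⟨
    Σℚ (λ i → μ i * c (suc i) l) + Σℚ (λ i → - c zero l * (μ i * a i))
      ≡⟨ Σℚ-+ (λ i → μ i * c (suc i) l) (λ i → - c zero l * (μ i * a i)) ⟨
    Σℚ (λ i → μ i * c (suc i) l + - c zero l * (μ i * a i))
      ≡⟨ Σℚ-cong (λ i → lemma′ (μ i) (c (suc i) l) (c zero l) (a i)) ⟩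
    Σℚ (λ i → μ i * (c (suc i) l - a i * c zero l))
      ≡⟨ cleared l ⟩
    0ℚ ∎
    where
    lemma : ∀ s z t → - s * z + t ≡ t + - z * s
    lemma = solve-∀ ℚ-ring
    lemma′ : ∀ m x z a → m * x + - z * (m * a) ≡ m * (x - a * z)
    lemma′ = solve-∀ ℚ-ring

-- The constant height 1 makes the condition Σ μ = 0 one more coordinate of a linear relation.
affInd⇒independent : ∀ {d k} (p : Fin (suc k) → Pt d) → AffInd p → Independent (λ i → hom 1ℤ (p i))
affInd⇒independent p ai μ rel = ai μ
  (trans (Σℚ-cong (λ i → sym (ℚP.*-identityʳ (μ i)))) (rel zero)) (λ j → rel (suc j))

independent⇒affInd : ∀ {d k} (p : Fin (suc k) → Pt d) → Independent (λ i → hom 1ℤ (p i)) → AffInd p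
independent⇒affInd p li μ Σμ≡0 rel = li μ
  (λ { zero → trans (Σℚ-cong (λ i → ℚP.*-identityʳ (μ i))) Σμ≡0 ; (suc j) → rel j })

-- A larger rank would give r + 2 affinely independent generators, by shortening the basis. With a
-- smaller one, the r + 1 generators from `Dim`, expanded in the basis, would have too few
-- coordinates to be independent.
rank-dim : ∀ {d m} (v : Fin (suc m) → Pt d) r → Dim v r → (𝓓 : Description (λ i → hom 1ℤ (v i))) →
  Description.rank 𝓓 ≡ suc r
rank-dim {d} v r ((f , ai) , maximal) 𝓓 = ℕP.≤-antisym (ℕP.≮⇒≥ not-more) (ℕP.≮⇒≥ not-less)
  where
  open Description 𝓓
  too-many : ∀ {ρ} (g : Fin ρ → Fin _) → Independent (λ i → hom 1ℤ (v (g i))) → ∀ j → ¬ (j ℕ.+ suc (suc r) ≡ ρ)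
  too-many g li j refl = maximal (g ∘ (j ↑ʳ_)) (independent⇒affInd (v ∘ g ∘ (j ↑ʳ_)) (independent-drop j _ li))
  not-more : ¬ (suc r ℕ.< rank)
  not-more r<ρ = too-many basis independent (rank ℕ.∸ suc (suc r)) (ℕP.m∸n+n≡m r<ρ)
  not-less : ¬ (rank ℕ.< suc r)
  not-less (s≤s ρ≤r) with dependence r (λ i → proj₁ (spanning (hom 1ℤ (v (f i))) (vanishing (f i)))) ρ≤r
  ... | μ , i , μi≢0 , rel = μi≢0 (affInd⇒independent (v ∘ f) ai μ rel′ i)
    where
    c : Fin (suc r) → Fin rank → ℚ
    c i = proj₁ (spanning (hom 1ℤ (v (f i))) (vanishing (f i)))
    b : Fin rank → Vector (suc d)
    b l = hom 1ℤ (v (basis l))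
    rel′ : ∀ j → Σℚ (λ i → μ i * hom 1ℤ (v (f i)) j) ≡ 0ℚ
    rel′ j = begin
      Σℚ (λ i → μ i * hom 1ℤ (v (f i)) j)
        ≡⟨ Σℚ-cong (λ i → trans (cong (μ i *_) (proj₂ (spanning (hom 1ℤ (v (f i))) (vanishing (f i))) j))
             (sym (Σℚ-*ˡ (μ i) (λ l → c i l * b l j)))) ⟩
      Σℚ (λ i → Σℚ (λ l → μ i * (c i l * b l j)))
        ≡⟨ Σℚ-swap (λ i l → μ i * (c i l * b l j)) ⟩
      Σℚ (λ l → Σℚ (λ i → μ i * (c i l * b l j)))
        ≡⟨ Σℚ-zero (λ l → trans (Σℚ-cong (λ i → lemma (μ i) (c i l) (b l j)))
             (trans (Σℚ-*ˡ (b l j) (λ i → μ i * c i l)) (trans (cong (b l j *_) (rel l)) (ℚP.*-zeroʳ (b l j))))) ⟩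
      0ℚ ∎
      where
      lemma : ∀ m c b → m * (c * b) ≡ b * (m * c)
      lemma = solve-∀ ℚ-ring

-- Ehrhart–Macdonald reciprocity

0<ℕ→ℚ : ∀ n → 0ℚ < ℕ→ℚ (suc n)
0<ℕ→ℚ n = ℚP.≰⇒> (λ n≤0 → case (ℤ→ℚ-cancel-≤ n≤0))
  where
  case : ¬ (ℤ.+ suc n ℤ.≤ 0ℤ)
  case (ℤ.+≤+ ())

neg-power : ∀ q i → (- q) ^ℚ i ≡ (- 1ℚ) ^ℚ i * q ^ℚ i
neg-power q zero    = refl
neg-power q (suc i) = trans (cong (- q *_) (neg-power q i)) (lemma q ((- 1ℚ) ^ℚ i) (q ^ℚ i))
  where
  lemma : ∀ q s p → - q * (s * p) ≡ (- 1ℚ * s) * (q * p)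
  lemma = solve-∀ ℚ-ring

sign-square : ∀ r → (- 1ℚ) ^ℚ r * (- 1ℚ) ^ℚ r ≡ 1ℚ
sign-square zero    = refl
sign-square (suc r) = trans (lemma ((- 1ℚ) ^ℚ r)) (sign-square r)
  where
  lemma : ∀ s → (- 1ℚ * s) * (- 1ℚ * s) ≡ s * s
  lemma = solve-∀ ℚ-ring

module Polytope {d m} (v : Fin (suc m) → Pt d) (𝓓 : Description (λ i → hom 1ℤ (v i)))
  (annihilated : ∀ y → ∇ (λ i → hom 1ℤ (v i)) (reciprocal 𝓓) y ≡ 0ℚ) where
  open Description 𝓓

  private
    V : Fin (suc m) → Vector (suc d)
    V i = hom 1ℤ (v i)

  dilate? : ∀ n x → Dec (InDilate v (suc n) x)
  dilate? n x = map′ (cone⇒dilate nonnegative v (suc n) x (0<ℕ→ℚ n)) (dilate⇒cone nonnegative v (suc n) x (0<ℕ→ℚ n))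
    (cone? (hom (ℤ.+ suc n) x))

  relint? : ∀ n x → Dec (InDilateRelint v (suc n) x)
  relint? n x = map′ (cone⇒dilate positive v (suc n) x (0<ℕ→ℚ n)) (dilate⇒cone positive v (suc n) x (0<ℕ→ℚ n))
    (interior? (hom (ℤ.+ suc n) x))

  dilate-card : ∀ n → ∃[ k ] HasCard (InDilate v (suc n)) k
  dilate-card n = hasCard-finite {S = InDilate v (suc n)} (λ x → dilate? n (lookup x)) _
    (λ x c → cone∈box nonnegative v (ℤ.+ suc n) x (dilate⇒cone nonnegative v (suc n) (lookup x) (0<ℕ→ℚ n) c))

  relint∈box : ∀ n x → InDilateRelint v (suc n) (lookup x) → x ∈ box d ∣ ℤ.+ radius v ℤ.* ℤ.+ suc n ∣
  relint∈box n x c = cone∈box positive v (ℤ.+ suc n) x (dilate⇒cone positive v (suc n) (lookup x) (0<ℕ→ℚ n) c)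

  opposite : Vec ℤ d → Vec ℤ d
  opposite = Vec.map (λ z → ℤ.- z)

  opposite-involutive : ∀ x → opposite (opposite x) ≡ x
  opposite-involutive x = lookup-ext (λ j → trans (VecP.lookup-map j _ (opposite x))
    (trans (cong (λ z → ℤ.- z) (VecP.lookup-map j _ x)) (ℤP.neg-involutive (lookup x j))))

  neg-hom : ∀ n x → neg (hom n (lookup x)) ≗ hom (ℤ.- n) (lookup (opposite x))
  neg-hom n x zero    = sym (ℤ→ℚ-neg n)
  neg-hom n x (suc j) = trans (sym (ℤ→ℚ-neg (lookup x j))) (cong ℤ→ℚ (sym (VecP.lookup-map j _ x)))

  interior-opposite : ∀ n x → Cone positive V (neg (hom n (lookup x))) → Cone positive V (hom (ℤ.- n) (lookup (opposite x)))
  interior-opposite n x = Cone-resp positive V (neg-hom n x)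

  sums : ∀ n → ∃[ c ] HasSum _≟ᵛ_ (λ x → reciprocal 𝓓 (hom n (lookup x))) c
  sums n = hasSum-finite _≟ᵛ_ (box d B) support
    where
    B = ∣ ℤ.+ radius v ℤ.* n ∣
    support : ∀ x → x ∈ box d B ⊎ reciprocal 𝓓 (hom n (lookup x)) ≡ 0ℚ
    support x with cone? (hom n (lookup x)) | interior? (neg (hom n (lookup x)))
    ... | yes c | _     = inj₁ (cone∈box nonnegative v n x c)
    ... | no _  | no _  = inj₂ (lemma (ε 𝓓))
      where
      lemma : ∀ e → 0ℚ - e * 0ℚ ≡ 0ℚ
      lemma = solve-∀ ℚ-ring
    -- Here -x lies in the slice of height -n; its box is the same one, since only absolute values
    -- enter.
    ... | no _  | yes c = inj₁ (∈-box x (λ j → subst₂ ℕ._≤_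
      (trans (cong ∣_∣ (VecP.lookup-map j _ x)) (ℤP.∣-i∣≡∣i∣ (lookup x j)))
      (trans (cong ∣_∣ (sym (ℤP.neg-distribʳ-* (ℤ.+ radius v) n))) (ℤP.∣-i∣≡∣i∣ (ℤ.+ radius v ℤ.* n)))
      (hom-bound positive v (ℤ.- n) (lookup (opposite x)) (interior-opposite n x c) j)))

  G : ℤ → ℚ
  G n = proj₁ (sums n)

  G-degree : DegreeBelow (suc m) G
  G-degree = lattice-degree v (reciprocal-ext 𝓓) (proj₂ ∘ sums) annihilated

  -- At a nonzero height y and -y have heights of opposite sign, so only one of the two terms of
  -- `reciprocal` survives.
  negative-height : ∀ P n x → n ℤ.< 0ℤ → ¬ Cone P V (hom n x)
  negative-height P n x n<0 c = ℤP.<⇒≱ n<0 (ℤ→ℚ-cancel-≤ (cone-height P V (λ _ → refl) (hom n x) c))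

  G-positive : ∀ n {k} → HasCard (InDilate v (suc n)) k → G (ℤ.+ suc n) ≡ ℕ→ℚ k
  G-positive n card = hasSum-unique _≟ᵛ_ (proj₂ (sums (ℤ.+ suc n)))
    (hasSum-cong _≟ᵛ_ pointwise (hasCard⇒hasSum {S = InDilate v (suc n)} (λ x → dilate? n (lookup x)) card))
    where
    lemma : ∀ a e → a ≡ a - e * 0ℚ
    lemma = solve-∀ ℚ-ring
    pointwise : ∀ x → ind (dilate? n (lookup x)) ≡ reciprocal 𝓓 (hom (ℤ.+ suc n) (lookup x))
    pointwise x = trans (ind-cong (dilate? n (lookup x)) (cone? (hom (ℤ.+ suc n) (lookup x)))
        (dilate⇒cone nonnegative v (suc n) (lookup x) (0<ℕ→ℚ n)) (cone⇒dilate nonnegative v (suc n) (lookup x) (0<ℕ→ℚ n)))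
      (trans (lemma _ (ε 𝓓)) (cong (λ q → [cone] 𝓓 (hom (ℤ.+ suc n) (lookup x)) - ε 𝓓 * q)
        (sym (ind-no (interior? _) (λ c → negative-height positive ℤ.-[1+ n ] _ ℤ.-<+ (interior-opposite (ℤ.+ suc n) x c))))))

  G-negative : ∀ n {k} → HasCard (InDilateRelint v (suc n)) k → G ℤ.-[1+ n ] ≡ - ε 𝓓 * ℕ→ℚ k
  G-negative n card = hasSum-unique _≟ᵛ_ (proj₂ (sums ℤ.-[1+ n ]))
    (hasSum-cong _≟ᵛ_ pointwise (hasSum-* _≟ᵛ_ (- ε 𝓓)
      (hasSum-reindex _≟ᵛ_ opposite opposite opposite-involutive opposite-involutive
        (hasCard⇒hasSum {S = InDilateRelint v (suc n)} (λ x → relint? n (lookup x)) card))))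
    where
    lemma : ∀ e i → - e * i ≡ 0ℚ - e * i
    lemma = solve-∀ ℚ-ring
    pointwise : ∀ x → - ε 𝓓 * ind (relint? n (lookup (opposite x))) ≡ reciprocal 𝓓 (hom ℤ.-[1+ n ] (lookup x))
    pointwise x = trans (lemma (ε 𝓓) _) (cong₂ (λ p q → p - ε 𝓓 * q)
      (sym (ind-no (cone? _) (negative-height nonnegative ℤ.-[1+ n ] (lookup x) ℤ.-<+)))
      (ind-cong (relint? n (lookup (opposite x))) (interior? (neg (hom ℤ.-[1+ n ] (lookup x))))
        (λ c → Cone-resp positive V (sym ∘ neg-hom ℤ.-[1+ n ] x) (dilate⇒cone positive v (suc n) (lookup (opposite x)) (0<ℕ→ℚ n) c))
        (λ c → cone⇒dilate positive v (suc n) (lookup (opposite x)) (0<ℕ→ℚ n) (interior-opposite ℤ.-[1+ n ] x c))))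

  ehrhart-reciprocity : ∀ r → Dim v r → (e : Fin (suc r) → ℚ) → IsEhrhart v r e →
    ∀ n k → HasCard (InDilateRelint v (suc n)) k →
    ℕ→ℚ k ≡ ((- 1ℚ) ^ℚ r) * Σℚ (λ i → e i * (((- 1ℚ) ^ℚ toℕ i) * (ℕ→ℚ (suc n) ^ℚ toℕ i)))
  ehrhart-reciprocity r dim e isE n k card = begin
    ℕ→ℚ k                              ≡⟨ ℚP.*-identityˡ (ℕ→ℚ k) ⟨
    1ℚ * ℕ→ℚ k                         ≡⟨ cong (_* ℕ→ℚ k) (sign-square r) ⟨
    (s * s) * ℕ→ℚ k                    ≡⟨ lemma s (ℕ→ℚ k) ⟩
    s * (- (- 1ℚ * s) * ℕ→ℚ k)         ≡⟨ cong (λ ρ → s * (- ((- 1ℚ) ^ℚ ρ) * ℕ→ℚ k)) (rank-dim v r dim 𝓓) ⟨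
    s * (- ε 𝓓 * ℕ→ℚ k)                ≡⟨ cong (s *_) (G-negative n card) ⟨
    s * G ℤ.-[1+ n ]                   ≡⟨ cong (s *_) G≡F ⟩
    s * F ℤ.-[1+ n ]                   ≡⟨ cong (s *_) (Σℚ-cong (λ i → cong (e i *_) (trans
      (cong (_^ℚ toℕ i) (ℤ→ℚ-neg (ℤ.+ suc n))) (neg-power (ℕ→ℚ (suc n)) (toℕ i))))) ⟩
    s * Σℚ (λ i → e i * (((- 1ℚ) ^ℚ toℕ i) * (ℕ→ℚ (suc n) ^ℚ toℕ i))) ∎
    where
    s : ℚ
    s = (- 1ℚ) ^ℚ r
    lemma : ∀ s k → (s * s) * k ≡ s * (- (- 1ℚ * s) * k)
    lemma = solve-∀ ℚ-ring
    F : ℤ → ℚ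
    F n = Σℚ (λ i → e i * (ℤ→ℚ n ^ℚ toℕ i))
    -- G is bounded through the m + 1 generators and F through its r + 1 coefficients; the sum of
    -- the two bounds serves both.
    difference : DegreeBelow (suc r ℕ.+ suc m) (λ n → G n + - 1ℚ * F n)
    difference = degree-+ (suc r ℕ.+ suc m) {G} {λ n → - 1ℚ * F n} (degree-weaken (suc r) (suc m) {G} G-degree)
      (degree-* (suc r ℕ.+ suc m) (- 1ℚ) {F} (subst (λ k → DegreeBelow k F) (ℕP.+-comm (suc m) (suc r))
        (degree-weaken (suc m) (suc r) {F} (degree-polynomial e))))
    -- `IsEhrhart` speaks about a cardinality that is already given; `dilate-card` produces it.
    positive-part : ∀ n → 1ℤ ℤ.≤ n → G n + - 1ℚ * F n ≡ 0ℚ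
    positive-part (ℤ.+ suc n) _ = trans (cong₂ (λ p q → p + - 1ℚ * q)
        (G-positive n (proj₂ (dilate-card n))) (isE (suc n) _ (proj₂ (dilate-card n))))
      (cancel (ℕ→ℚ (proj₁ (dilate-card n))))
      where
      cancel : ∀ q → q + - 1ℚ * q ≡ 0ℚ
      cancel = solve-∀ ℚ-ring
    positive-part (ℤ.+ zero) (ℤ.+≤+ ())
    G≡F : G ℤ.-[1+ n ] ≡ F ℤ.-[1+ n ]
    G≡F = trans (split (G ℤ.-[1+ n ]) (F ℤ.-[1+ n ]))
      (trans (cong (_+ F ℤ.-[1+ n ]) (degree-vanishing (suc r ℕ.+ suc m) difference 1ℤ positive-part ℤ.-[1+ n ]))
        (ℚP.+-identityˡ _))
      where
      split : ∀ a b → a ≡ (a + - 1ℚ * b) + b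
      split = solve-∀ ℚ-ring

-- Divisor sums

range : ℕ → List ℕ
range n = map suc (upTo n)

∈-range⁺ : ∀ {n a} → 1 ℕ.≤ a → a ℕ.≤ n → a ∈ range n
∈-range⁺ {a = suc a} _ a<n = ∈-map⁺ suc (∈-upTo⁺ a<n)

∈-range⁻ : ∀ {n a} → a ∈ range n → 1 ℕ.≤ a × a ℕ.≤ n
∈-range⁻ a∈ with ∈-map⁻ suc a∈
... | b , b∈ , refl = s≤s z≤n , ∈-upTo⁻ b∈

range-unique : ∀ n → Unique (range n)
range-unique n = UniqueP.map⁺ ℕP.suc-injective (UniqueP.upTo⁺ n)

divisors : ℕ → List ℕ
divisors n = filter (_∣? n) (range n)

divisors-unique : ∀ n → Unique (divisors n)
divisors-unique n = UniqueP.filter⁺ (_∣? n) (range-unique n)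

∈-divisors⁺ : ∀ {n δ} → 1 ℕ.≤ n → δ ∣ n → δ ∈ divisors n
∈-divisors⁺ {suc n} {δ} _ δ∣n = ∈-filter⁺ (_∣? suc n) (∈-range⁺ (positive-divisor δ δ∣n) (∣⇒≤ δ∣n)) δ∣n
  where
  positive-divisor : ∀ δ → δ ∣ suc n → 1 ℕ.≤ δ
  positive-divisor zero    (divides q eq) with trans eq (ℕP.*-zeroʳ q)
  ... | ()
  positive-divisor (suc δ) _ = s≤s z≤n

∈-divisors⁻ : ∀ {n δ} → δ ∈ divisors n → 1 ℕ.≤ δ × δ ℕ.≤ n × δ ∣ n
∈-divisors⁻ {n} {δ} δ∈ with ∈-filter⁻ (_∣? n) {xs = range n} δ∈
... | δ∈range , δ∣n = proj₁ (∈-range⁻ δ∈range) , proj₂ (∈-range⁻ δ∈range) , δ∣n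

-- Takes the place of Möbius inversion: by strong induction the difference vanishes at all proper
-- divisors, so its divisor sum is just its value at n.
divisorSum-injective : ∀ (a b : ℕ → ℚ) → (∀ n → 1 ℕ.≤ n → ∑ a (divisors n) ≡ ∑ b (divisors n)) →
  ∀ n → 1 ℕ.≤ n → a n ≡ b n
divisorSum-injective a b sums = <-rec (λ n → 1 ℕ.≤ n → a n ≡ b n) step
  where
  f : ℕ → ℚ
  f n = a n + - 1ℚ * b n
  f≡0⇒a≡b : ∀ p q → p + - 1ℚ * q ≡ 0ℚ → p ≡ q
  f≡0⇒a≡b p q eq = trans (lemma p q) (trans (cong (_+ q) eq) (ℚP.+-identityˡ q))
    where
    lemma : ∀ p q → p ≡ (p + - 1ℚ * q) + q
    lemma = solve-∀ ℚ-ring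
  a≡b⇒f≡0 : ∀ p q → p ≡ q → p + - 1ℚ * q ≡ 0ℚ
  a≡b⇒f≡0 p q refl = lemma p
    where
    lemma : ∀ p → p + - 1ℚ * p ≡ 0ℚ
    lemma = solve-∀ ℚ-ring
  step : ∀ n → (∀ {δ} → δ ℕ.< n → 1 ℕ.≤ δ → a δ ≡ b δ) → 1 ℕ.≤ n → a n ≡ b n
  step n ih n≥1 = f≡0⇒a≡b (a n) (b n) (begin
    f n                     ≡⟨ ℚP.+-identityʳ (f n) ⟨
    ∑ f (n ∷ [])            ≡⟨ ∑-support ℕP._≟_ ([] ∷ []) (divisors-unique n) f
                                 (λ { _ (here refl) → inj₁ (∈-divisors⁺ n≥1 ∣-refl) }) proper ⟩
    ∑ f (divisors n)        ≡⟨ trans (∑-+ a (λ δ → - 1ℚ * b δ) (divisors n)) (cong (∑ a (divisors n) +_) (∑-* (- 1ℚ) b (divisors n))) ⟩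
    ∑ a (divisors n) + - 1ℚ * ∑ b (divisors n) ≡⟨ a≡b⇒f≡0 _ _ (sums n n≥1) ⟩
    0ℚ                      ∎)
    where
    proper : ∀ δ → δ ∈ divisors n → δ ∈ n ∷ [] ⊎ f δ ≡ 0ℚ
    proper δ δ∈ with δ ℕP.≟ n
    ... | yes refl = inj₁ (here refl)
    ... | no  δ≢n  = let (δ≥1 , δ≤n , _) = ∈-divisors⁻ δ∈ in
          inj₂ (a≡b⇒f≡0 (a δ) (b δ) (ih (ℕP.≤∧≢⇒< δ≤n δ≢n) δ≥1))

-- Points sorted by their gcd with n

-- Shared by the points of ℤ^d and by the tuples that J counts, so that both divisor sums come from
-- a single partition argument. The number γ x n is the gcd of the coordinates of x and n.
record GCDStructure (X : Set) : Set where
  field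
    _≟_             : DecidableEquality X
    γ               : X → ℕ → ℕ
    scale           : ℕ → X → X
    scale-injective : ∀ {g x y} → scale (suc g) x ≡ scale (suc g) y → x ≡ y
    γ-scale         : ∀ g x n → γ (scale g x) (g ℕ.* n) ≡ g ℕ.* γ x n
    γ∣n             : ∀ x n → γ x n ∣ n
    divide          : ∀ x n → ∃[ y ] (x ≡ scale (γ x n) y)

Enumerates : {X : Set} → List X → (X → Set) → Set
Enumerates L S = Unique L × (∀ x → (x ∈ L) ⇔ S x)

module _ {X : Set} (𝓖 : GCDStructure X) where
  open GCDStructure 𝓖

  -- A point with gcd g at level n is g times a unique point with gcd 1 at level δ = n / g, and
  -- homogeneity of S keeps membership. Grouping by δ gives the divisor sum.
  gcd-partition : (S : ℕ → X → Set) → (∀ g n x → 1 ℕ.≤ g → S n x ⇔ S (g ℕ.* n) (scale g x)) →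
    (L C : ℕ → List X) → (∀ n → 1 ℕ.≤ n → Enumerates (L n) (S n)) →
    (∀ n → 1 ℕ.≤ n → Enumerates (C n) (λ x → S n x × γ x n ≡ 1)) →
    ∀ n → 1 ℕ.≤ n → ℕ→ℚ (length (L n)) ≡ ∑ (λ δ → ℕ→ℚ (length (C δ))) (divisors n)
  gcd-partition S homogeneous L C enumL enumC n n≥1 = begin
    ℕ→ℚ (length (L n))                                      ≡⟨ ∑-one (L n) ⟨
    ∑ (λ _ → 1ℚ) (L n)                                      ≡⟨ ∑-cong (L n) (λ x _ → sym (one-divisor x)) ⟩
    ∑ (λ x → ∑ (λ δ → level δ x) (divisors n)) (L n)        ≡⟨ ∑-swap (λ x δ → level δ x) (L n) (divisors n) ⟩
    ∑ (λ δ → ∑ (level δ) (L n)) (divisors n)                ≡⟨ ∑-cong (divisors n) (λ δ δ∈ → level-count δ (∈-divisors⁻ δ∈)) ⟩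
    ∑ (λ δ → ℕ→ℚ (length (C δ))) (divisors n)               ∎
    where
    level : ℕ → X → ℚ
    -- The condition δ = n / γ, written as a product to avoid division.
    level δ x = ind (γ x n ℕ.* δ ℕP.≟ n)
    one-divisor : ∀ x → ∑ (λ δ → level δ x) (divisors n) ≡ 1ℚ
    one-divisor x with γ x n | γ∣n x n
    ... | g | divides q n≡q*g = trans
      (∑-cong (divisors n) (λ δ _ → ind-cong (g ℕ.* δ ℕP.≟ n) (q ℕP.≟ δ)
        (λ gδ≡n → sym (ℕP.*-cancelˡ-≡ δ q g {{g≢0}} (trans gδ≡n n≡g*q)))
        (λ { refl → sym n≡g*q })))
      (∑-point ℕP._≟_ (divisors-unique n) (∈-divisors⁺ n≥1 (divides g n≡g*q)))
      where
      n≡g*q : n ≡ g ℕ.* q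
      n≡g*q = trans n≡q*g (ℕP.*-comm q g)
      g≢0 : ℕ.NonZero g
      g≢0 = ℕP.m*n≢0⇒n≢0 q {{subst ℕ.NonZero n≡q*g (ℕ.>-nonZero n≥1)}}
    level-count : ∀ δ → 1 ℕ.≤ δ × δ ℕ.≤ n × δ ∣ n → ∑ (level δ) (L n) ≡ ℕ→ℚ (length (C δ))
    level-count δ (δ≥1 , _ , divides zero n≡0) = contradiction (subst (1 ℕ.≤_) n≡0 n≥1) (λ ())
    level-count δ (δ≥1 , _ , divides (suc g) n≡gδ) = begin
      ∑ (level δ) (L n)                     ≡⟨ ∑-support _≟_ (proj₁ (enumL n n≥1))
                                                 (UniqueP.map⁺ scale-injective (proj₁ (enumC δ δ≥1))) (level δ) divided∈C scaled∈L ⟩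
      ∑ (level δ) (map (scale (suc g)) (C δ))  ≡⟨ ∑-map (scale (suc g)) (level δ) (C δ) ⟩
      ∑ (level δ ∘ scale (suc g)) (C δ)     ≡⟨ ∑-cong (C δ) (λ x x∈C → ind-yes (_ ℕP.≟ n)
                                                 (on-level x (proj₂ (Equivalence.to (proj₂ (enumC δ δ≥1) x) x∈C)))) ⟩
      ∑ (λ _ → 1ℚ) (C δ)                    ≡⟨ ∑-one (C δ) ⟩
      ℕ→ℚ (length (C δ))                    ∎
      where
      instance
        δ≢0 : ℕ.NonZero δ
        δ≢0 = ℕ.>-nonZero δ≥1
      γ-scaled : ∀ x → γ (scale (suc g) x) n ≡ suc g ℕ.* γ x δ
      γ-scaled x = trans (cong (γ (scale (suc g) x)) n≡gδ) (γ-scale (suc g) x δ)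
      on-level : ∀ x → γ x δ ≡ 1 → γ (scale (suc g) x) n ℕ.* δ ≡ n
      on-level x γ≡1 = trans (cong (ℕ._* δ) (trans (γ-scaled x) (trans (cong (suc g ℕ.*_) γ≡1) (ℕP.*-identityʳ (suc g))))) (sym n≡gδ)
      scaled∈L : ∀ x → x ∈ map (scale (suc g)) (C δ) → x ∈ L n ⊎ level δ x ≡ 0ℚ
      scaled∈L x x∈ with ∈-map⁻ (scale (suc g)) x∈
      ... | y , y∈C , refl = inj₁ (Equivalence.from (proj₂ (enumL n n≥1) _) (subst (λ k → S k (scale (suc g) y)) (sym n≡gδ)
        (Equivalence.to (homogeneous (suc g) δ y (s≤s z≤n)) (proj₁ (Equivalence.to (proj₂ (enumC δ δ≥1) y) y∈C)))))
      divided∈C : ∀ x → x ∈ L n → x ∈ map (scale (suc g)) (C δ) ⊎ level δ x ≡ 0ℚ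
      divided∈C x x∈L with γ x n ℕ.* δ ℕP.≟ n
      ... | no  _    = inj₂ refl
      ... | yes γδ≡n = inj₁ (subst (_∈ map (scale (suc g)) (C δ)) (sym x≡gy) (∈-map⁺ (scale (suc g))
              (Equivalence.from (proj₂ (enumC δ δ≥1) y) (Sy , γy≡1))))
        where
        γ≡g : γ x n ≡ suc g
        γ≡g = ℕP.*-cancelʳ-≡ (γ x n) (suc g) δ (trans γδ≡n n≡gδ)
        y : X
        y = proj₁ (divide x n)
        x≡gy : x ≡ scale (suc g) y
        x≡gy = trans (proj₂ (divide x n)) (cong (λ k → scale k y) γ≡g)
        Sy : S δ y
        Sy = Equivalence.from (homogeneous (suc g) δ y (s≤s z≤n))
          (subst₂ S n≡gδ x≡gy (Equivalence.to (proj₂ (enumL n n≥1) x) x∈L))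
        γy≡1 : γ y δ ≡ 1
        γy≡1 = ℕP.*-cancelˡ-≡ (γ y δ) 1 (suc g) (begin
          suc g ℕ.* γ y δ             ≡⟨ γ-scaled y ⟨
          γ (scale (suc g) y) n       ≡⟨ cong (λ z → γ z n) x≡gy ⟨
          γ x n                       ≡⟨ γ≡g ⟩
          suc g                       ≡⟨ ℕP.*-identityʳ (suc g) ⟨
          suc g ℕ.* 1                 ∎)

latticeGCD : ∀ d → GCDStructure (Vec ℤ d)
latticeGCD d = record
  { _≟_             = _≟ᵛ_
  ; γ               = λ x → gcdPt (lookup x)
  ; scale           = scale
  ; scale-injective = λ {g} → scale-injective g
  ; γ-scale         = γ-scale
  ; γ∣n             = γ∣n
  ; divide          = λ x n → divide x n ∣-refl
  }
  where
  scale : ∀ {d} → ℕ → Vec ℤ d → Vec ℤ d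
  scale g = Vec.map (λ z → ℤ.+ g ℤ.* z)
  scale-injective : ∀ {d} g {x y : Vec ℤ d} → scale (suc g) x ≡ scale (suc g) y → x ≡ y
  scale-injective g {[]}    {[]}    _  = refl
  scale-injective g {a ∷ x} {b ∷ y} eq = cong₂ _∷_
    (ℤP.*-cancelˡ-≡ (ℤ.+ suc g) a b (VecP.∷-injectiveˡ eq)) (scale-injective g (VecP.∷-injectiveʳ eq))
  γ-scale : ∀ {d} g (x : Vec ℤ d) n → gcdPt (lookup (scale g x)) (g ℕ.* n) ≡ g ℕ.* gcdPt (lookup x) n
  γ-scale g []      n = refl
  γ-scale g (a ∷ x) n = trans (cong₂ gcd (ℤP.abs-* (ℤ.+ g) a) (γ-scale g x n))
    (sym (c*gcd[m,n]≡gcd[cm,cn] g ∣ a ∣ (gcdPt (lookup x) n)))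
  γ∣n : ∀ {d} (x : Vec ℤ d) n → gcdPt (lookup x) n ∣ n
  γ∣n []      n = ∣-refl
  γ∣n (a ∷ x) n = ∣-trans (gcd[m,n]∣n ∣ a ∣ _) (γ∣n x n)
  -- Generalised to every divisor g of the gcd, because the gcd of the tail may be larger than that
  -- of the whole vector.
  divide : ∀ {d} {g} (x : Vec ℤ d) n → g ∣ gcdPt (lookup x) n → ∃[ y ] (x ≡ scale g y)
  divide []      n g∣γ = [] , refl
  divide {g = g} (a ∷ x) n g∣γ with divide x n (∣-trans g∣γ (gcd[m,n]∣n ∣ a ∣ _))
                                  | Signed.∣ᵤ⇒∣ {ℤ.+ g} {a} (∣-trans g∣γ (gcd[m,n]∣m ∣ a ∣ _))
  ... | y , x≡gy | Signed.divides b a≡bg = b ∷ y , cong₂ _∷_ (trans a≡bg (ℤP.*-comm b (ℤ.+ g))) x≡gy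

tupleGCD : ∀ k → GCDStructure (Vec ℕ k)
tupleGCD k = record
  { _≟_             = VecP.≡-dec ℕP._≟_
  ; γ               = gcdVec
  ; scale           = scale
  ; scale-injective = λ {g} → scale-injective g
  ; γ-scale         = γ-scale
  ; γ∣n             = γ∣n
  ; divide          = λ x n → divide x n ∣-refl
  }
  where
  scale : ∀ {k} → ℕ → Vec ℕ k → Vec ℕ k
  scale g = Vec.map (g ℕ.*_)
  scale-injective : ∀ {k} g {x y : Vec ℕ k} → scale (suc g) x ≡ scale (suc g) y → x ≡ y
  scale-injective g {[]}    {[]}    _  = refl
  scale-injective g {a ∷ x} {b ∷ y} eq = cong₂ _∷_
    (ℕP.*-cancelˡ-≡ a b (suc g) (VecP.∷-injectiveˡ eq)) (scale-injective g (VecP.∷-injectiveʳ eq))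
  γ-scale : ∀ {k} g (x : Vec ℕ k) n → gcdVec (scale g x) (g ℕ.* n) ≡ g ℕ.* gcdVec x n
  γ-scale g []      n = refl
  γ-scale g (a ∷ x) n = trans (cong (gcd (g ℕ.* a)) (γ-scale g x n)) (sym (c*gcd[m,n]≡gcd[cm,cn] g a (gcdVec x n)))
  γ∣n : ∀ {k} (x : Vec ℕ k) n → gcdVec x n ∣ n
  γ∣n []      n = ∣-refl
  γ∣n (a ∷ x) n = ∣-trans (gcd[m,n]∣n a _) (γ∣n x n)
  divide : ∀ {k} {g} (x : Vec ℕ k) n → g ∣ gcdVec x n → ∃[ y ] (x ≡ scale g y)
  divide []      n g∣γ = [] , refl
  divide {g = g} (a ∷ x) n g∣γ with divide x n (∣-trans g∣γ (gcd[m,n]∣n a _)) | ∣-trans g∣γ (gcd[m,n]∣m a _)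
  ... | y , x≡gy | divides b a≡bg = b ∷ y , cong₂ _∷_ (trans a≡bg (ℕP.*-comm b g)) x≡gy

-- Jordan totients

-- The lattice points of the half-open cube (0, n]^k. Both of its defining inequalities survive
-- multiplication and division by g, as `gcd-partition` requires.
InCube : ∀ {k} → ℕ → Vec ℕ k → Set
InCube n []      = ⊤
InCube n (a ∷ t) = (1 ℕ.≤ a × a ℕ.≤ n) × InCube n t

concatMap-map : ∀ {A B C : Set} (f : A → B → C) xs ys → concatMap (λ a → map (f a) ys) xs ≡ cartesianProductWith f xs ys
concatMap-map f []       ys = refl
concatMap-map f (x ∷ xs) ys = cong (map (f x) ys ++_) (concatMap-map f xs ys)

tuples-suc : ∀ k n → tuples (suc k) n ≡ cartesianProductWith _∷_ (range n) (tuples k n)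
tuples-suc k n = concatMap-map _∷_ (range n) (tuples k n)

tuples-enumerates : ∀ k n → Enumerates (tuples k n) (InCube n)
tuples-enumerates zero    n = [] ∷ [] , λ { [] → mk⇔ (λ _ → tt) (λ _ → here refl) }
tuples-enumerates (suc k) n = subst (λ L → Enumerates L (InCube n)) (sym (tuples-suc k n))
  ( UniqueP.cartesianProductWith⁺ _∷_ (λ eq → VecP.∷-injective eq) (range-unique n) (proj₁ ih) , mem )
  where
  ih = tuples-enumerates k n
  mem : ∀ t → (t ∈ cartesianProductWith _∷_ (range n) (tuples k n)) ⇔ InCube n t
  mem (a ∷ t) = mk⇔ to from
    where
    to : a ∷ t ∈ cartesianProductWith _∷_ (range n) (tuples k n) → InCube n (a ∷ t)
    to at∈ with ∈-cartesianProductWith⁻ _∷_ (range n) (tuples k n) at∈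
    ... | _ , _ , a∈ , t∈ , refl = ∈-range⁻ a∈ , Equivalence.to (proj₂ ih t) t∈
    from : InCube n (a ∷ t) → a ∷ t ∈ cartesianProductWith _∷_ (range n) (tuples k n)
    from ((1≤a , a≤n) , ct) = ∈-cartesianProductWith⁺ _∷_ (∈-range⁺ 1≤a a≤n) (Equivalence.from (proj₂ ih t) ct)

InCube-homogeneous : ∀ {k} g n (t : Vec ℕ k) → 1 ℕ.≤ g → InCube n t ⇔ InCube (g ℕ.* n) (Vec.map (g ℕ.*_) t)
InCube-homogeneous g n []      _   = mk⇔ (λ _ → tt) (λ _ → tt)
InCube-homogeneous g@(suc _) n (a ∷ t) g≥1 = mk⇔
  (λ { ((1≤a , a≤n) , ct) → (ℕP.*-mono-≤ g≥1 1≤a , ℕP.*-monoʳ-≤ g a≤n) , Equivalence.to ih ct })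
  (λ { ((1≤ga , ga≤gn) , ct) → (positive-factor a 1≤ga , ℕP.*-cancelˡ-≤ g ga≤gn) , Equivalence.from ih ct })
  where
  ih = InCube-homogeneous g n t g≥1
  positive-factor : ∀ a → 1 ℕ.≤ g ℕ.* a → 1 ℕ.≤ a
  positive-factor zero    h = subst (1 ℕ.≤_) (ℕP.*-zeroʳ g) h
  positive-factor (suc a) _ = s≤s z≤n

length-cartesianProductWith : ∀ {A B C : Set} (f : A → B → C) xs ys →
  length (cartesianProductWith f xs ys) ≡ length xs ℕ.* length ys
length-cartesianProductWith f []       ys = refl
length-cartesianProductWith f (x ∷ xs) ys = trans (ListP.length-++ (map (f x) ys))
  (cong₂ ℕ._+_ (ListP.length-map (f x) ys) (length-cartesianProductWith f xs ys))

tuples-length : ∀ k n → ℕ→ℚ (length (tuples k n)) ≡ ℕ→ℚ n ^ℚ k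
tuples-length zero    n = refl
tuples-length (suc k) n = begin
  ℕ→ℚ (length (tuples (suc k) n))            ≡⟨ cong (ℕ→ℚ ∘ length) (tuples-suc k n) ⟩
  ℕ→ℚ (length (cartesianProductWith Vec._∷_ (range n) (tuples k n)))
    ≡⟨ cong ℕ→ℚ (length-cartesianProductWith Vec._∷_ (range n) (tuples k n)) ⟩
  ℕ→ℚ (length (range n) ℕ.* length (tuples k n))
    ≡⟨ cong (λ l → ℕ→ℚ (l ℕ.* length (tuples k n))) (trans (ListP.length-map suc (upTo n)) (ListP.length-upTo n)) ⟩
  ℕ→ℚ (n ℕ.* length (tuples k n))            ≡⟨ ℕ→ℚ-* n (length (tuples k n)) ⟩
  ℕ→ℚ n * ℕ→ℚ (length (tuples k n))          ≡⟨ cong (ℕ→ℚ n *_) (tuples-length k n) ⟩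
  ℕ→ℚ n * ℕ→ℚ n ^ℚ k                         ∎
  where
  ℕ→ℚ-* : ∀ a b → ℕ→ℚ (a ℕ.* b) ≡ ℕ→ℚ a * ℕ→ℚ b
  ℕ→ℚ-* a b = trans (cong ℤ→ℚ (ℤP.pos-* a b)) (ℤ→ℚ-* (ℤ.+ a) (ℤ.+ b))

jordan-divisorSum : ∀ k n → 1 ℕ.≤ n → ∑ (λ δ → ℕ→ℚ (J k δ)) (divisors n) ≡ ℕ→ℚ n ^ℚ k
jordan-divisorSum k n n≥1 = trans (sym (gcd-partition (tupleGCD k) InCube InCube-homogeneous (tuples k)
    (λ n → filter (λ t → gcdVec t n ℕ.≟ 1) (tuples k n)) (λ n _ → tuples-enumerates k n) coprime n n≥1))
  (tuples-length k n)
  where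
  coprime : ∀ n → 1 ℕ.≤ n → Enumerates (filter (λ t → gcdVec t n ℕ.≟ 1) (tuples k n)) (λ t → InCube n t × gcdVec t n ≡ 1)
  coprime n _ = UniqueP.filter⁺ _ (proj₁ (tuples-enumerates k n)) , λ t → mk⇔
    (λ t∈ → let (t∈′ , g≡1) = ∈-filter⁻ (λ t → gcdVec t n ℕ.≟ 1) {xs = tuples k n} t∈ in
            Equivalence.to (proj₂ (tuples-enumerates k n) t) t∈′ , g≡1)
    (λ { (ct , g≡1) → ∈-filter⁺ (λ t → gcdVec t n ℕ.≟ 1) (Equivalence.from (proj₂ (tuples-enumerates k n) t) ct) g≡1 })

∑-Σℚ : ∀ {A : Set} {k} (f : Fin k → A → ℚ) L → ∑ (λ x → Σℚ (λ i → f i x)) L ≡ Σℚ (λ i → ∑ (f i) L)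
∑-Σℚ f []      = sym (Σℚ-zero {f = λ i → ∑ (f i) []} (λ _ → refl))
∑-Σℚ f (x ∷ L) = trans (cong (Σℚ (λ i → f i x) +_) (∑-Σℚ f L)) (sym (Σℚ-+ (λ i → f i x) (λ i → ∑ (f i) L)))

-- The same convex weights serve on both sides; only the factor g is inserted or cancelled.
relint-homogeneous : ∀ {d m} (v : Fin (suc m) → Pt d) g n x → 1 ℕ.≤ g →
  InDilateRelint v n (lookup x) ⇔ InDilateRelint v (g ℕ.* n) (lookup (GCDStructure.scale (latticeGCD d) g x))
relint-homogeneous {d} v (suc g-1) n x _ = mk⇔
  (λ { (μ , μ>0 , Σμ , eq) → μ , μ>0 , Σμ , λ j → trans (scaled j) (trans (cong (ℕ→ℚ g *_) (eq j)) (sym (factor _))) })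
  (λ { (μ , μ>0 , Σμ , eq) → μ , μ>0 , Σμ , λ j → cancel _ _ (trans (sym (scaled j)) (trans (eq j) (factor _))) })
  where
  g : ℕ
  g = suc g-1
  scaled : ∀ j → ℤ→ℚ (lookup (GCDStructure.scale (latticeGCD d) g x) j) ≡ ℕ→ℚ g * ℤ→ℚ (lookup x j)
  scaled j = trans (cong ℤ→ℚ (VecP.lookup-map j _ x)) (ℤ→ℚ-* (ℤ.+ g) (lookup x j))
  factor : ∀ q → ℕ→ℚ (g ℕ.* n) * q ≡ ℕ→ℚ g * (ℕ→ℚ n * q)
  factor q = trans (cong (_* q) (trans (cong ℤ→ℚ (ℤP.pos-* g n)) (ℤ→ℚ-* (ℤ.+ g) (ℤ.+ n)))) (ℚP.*-assoc (ℕ→ℚ g) (ℕ→ℚ n) q)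
  cancel : ∀ p q → ℕ→ℚ g * p ≡ ℕ→ℚ g * q → p ≡ q
  cancel p q eq with inverse-pos (0<ℕ→ℚ g-1)
  ... | c , _ , inv = trans (unscale p) (trans (cong (c *_) eq) (sym (unscale q)))
    where
    unscale : ∀ p → p ≡ c * (ℕ→ℚ g * p)
    unscale p = trans (sym (ℚP.*-identityˡ p)) (trans (cong (_* p) (sym inv)) (ℚP.*-assoc c (ℕ→ℚ g) p))

-- Passage to coprime lattice points

module _ {d m} (v : Fin (suc m) → Pt d) (r : ℕ) (dim : Dim v r) (e : Fin (suc r) → ℚ) (isE : IsEhrhart v r e)
  (𝓓 : Description (λ i → hom 1ℤ (v i))) (annihilated : ∀ y → ∇ (λ i → hom 1ℤ (v i)) (reciprocal 𝓓) y ≡ 0ℚ) where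

  open Polytope v 𝓓 annihilated

  private
    relint-card : ∀ n → ∃[ k ] HasCard (InDilateRelint v (suc n)) k
    relint-card n = hasCard-finite {S = InDilateRelint v (suc n)} (λ x → relint? n (lookup x)) _ (relint∈box n)

    points coprimePoints : ℕ → List (Vec ℤ d)
    -- A default value; the enumerations are stated for n ≥ 1.
    points zero    = []
    points (suc n) = proj₁ (proj₂ (relint-card n))
    coprimePoints n = filter (λ x → gcdPt (lookup x) n ℕ.≟ 1) (points n)

    points-enumerates : ∀ n → 1 ℕ.≤ n → Enumerates (points n) (InDilateRelint v n ∘ lookup)
    points-enumerates (suc n) _ = let (_ , uL , L⇔ , _) = proj₂ (relint-card n) in uL , L⇔

    coprime-enumerates : ∀ n → 1 ℕ.≤ n →
      Enumerates (coprimePoints n) (λ x → InDilateRelint v n (lookup x) × gcdPt (lookup x) n ≡ 1)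
    coprime-enumerates n n≥1 = UniqueP.filter⁺ coprime? (proj₁ (points-enumerates n n≥1)) , λ x → mk⇔
      (λ x∈ → let (x∈L , g≡1) = ∈-filter⁻ coprime? {xs = points n} x∈ in
              Equivalence.to (proj₂ (points-enumerates n n≥1) x) x∈L , g≡1)
      (λ { (s , g≡1) → ∈-filter⁺ coprime? (Equivalence.from (proj₂ (points-enumerates n n≥1) x) s) g≡1 })
      where coprime? = λ (x : Vec ℤ d) → gcdPt (lookup x) n ℕ.≟ 1

    count reciprocalCount : ℕ → ℚ
    count n           = ℕ→ℚ (length (coprimePoints n))
    reciprocalCount n = ((- 1ℚ) ^ℚ r) * CEneg e n

    -- Summing over divisors replaces each J_i by the power n^i, which turns `CEneg` into the
    -- Ehrhart polynomial at -n. This is the value that `ehrhart-reciprocity` assigns to the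
    -- interior points.
    jordan-sum : ∀ n → 1 ℕ.≤ n → ∑ reciprocalCount (divisors n) ≡
      ((- 1ℚ) ^ℚ r) * Σℚ (λ i → e i * (((- 1ℚ) ^ℚ toℕ i) * (ℕ→ℚ n ^ℚ toℕ i)))
    jordan-sum n n≥1 = trans (∑-* ((- 1ℚ) ^ℚ r) (CEneg e) (divisors n)) (cong (((- 1ℚ) ^ℚ r) *_)
      (trans (∑-Σℚ (λ i δ → e i * (((- 1ℚ) ^ℚ toℕ i) * ℕ→ℚ (J (toℕ i) δ))) (divisors n))
        (Σℚ-cong (λ i → trans (∑-* (e i) _ (divisors n)) (cong (e i *_)
          (trans (∑-* ((- 1ℚ) ^ℚ toℕ i) _ (divisors n)) (cong (((- 1ℚ) ^ℚ toℕ i) *_) (jordan-divisorSum (toℕ i) n n≥1))))))))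

    count-sum : ∀ n → 1 ℕ.≤ n → ∑ count (divisors n) ≡
      ((- 1ℚ) ^ℚ r) * Σℚ (λ i → e i * (((- 1ℚ) ^ℚ toℕ i) * (ℕ→ℚ n ^ℚ toℕ i)))
    count-sum n@(suc n-1) n≥1 = trans
      (sym (gcd-partition (latticeGCD d) (λ n → InDilateRelint v n ∘ lookup) (relint-homogeneous v)
        points coprimePoints points-enumerates coprime-enumerates n n≥1))
      (ehrhart-reciprocity r dim e isE n-1 _ (points n , proj₁ (points-enumerates n n≥1) , proj₂ (points-enumerates n n≥1) , refl))

  coprime-reciprocity : ∀ n → 1 ℕ.≤ n → ∀ k → HasCard (CESet (InDilateRelint v) n) k →
    ℕ→ℚ k ≡ ((- 1ℚ) ^ℚ r) * CEneg e n
  coprime-reciprocity n n≥1 k (K , uK , K⇔ , refl) = begin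
    ℕ→ℚ (length K)                    ≡⟨ ∑-one K ⟨
    ∑ (λ _ → 1ℚ) K                    ≡⟨ ∑-support _≟ᵛ_ uK (proj₁ enum) (λ _ → 1ℚ)
      (λ x x∈K → inj₁ (Equivalence.from (proj₂ enum x) (Equivalence.to (K⇔ x) x∈K)))
      (λ x x∈C → inj₁ (Equivalence.from (K⇔ x) (Equivalence.to (proj₂ enum x) x∈C))) ⟩
    ∑ (λ _ → 1ℚ) (coprimePoints n)    ≡⟨ ∑-one (coprimePoints n) ⟩
    count n                           ≡⟨ divisorSum-injective count reciprocalCount
      (λ n n≥1 → trans (count-sum n n≥1) (sym (jordan-sum n n≥1))) n n≥1 ⟩
    ((- 1ℚ) ^ℚ r) * CEneg e n         ∎
    where enum = coprime-enumerates n n≥1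

theorem1p2 : ∀ {d m : ℕ} (v : Fin (suc m) → Pt d) (r : ℕ) → Dim v r →
    (e : Fin (suc r) → ℚ) → IsEhrhart v r e →
    ∀ (n : ℕ) → n ≥ 1 → ∀ (k : ℕ) → HasCard (CESet (InDilateRelint v) n) k →
    ℕ→ℚ k ≡ ((- 1ℚ) ^ℚ r) * CEneg e n
theorem1p2 v r dim e isE =
  let (𝓓 , annihilated) = cone-reciprocity (λ i → hom 1ℤ (v i)) (λ _ → refl)
  in coprime-reciprocity v r dim e isE 𝓓 annihilated
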